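{- Let $\alpha\in \mathrm{GL}(8,2)$ be the matrix \[ \alpha= \begin{bmatrix} 0& 0& 0& 0& 0& 0& 0& 1 \\ 1& 0& 0& 0& 0& 0& 0& 0 \\ 0& 1& 0& 0& 0& 0& 0& 1 \\ 0& 0& 1& 0& 0& 0& 0& 1 \\ 0& 0& 0& 1& 0& 0& 0& 1 \\ 0& 0& 0& 0& 1& 0& 0& 0 \\ 0& 0& 0& 0& 0& 1& 0& 0 \\ 0& 0& 0& 0& 0& 0& 1& 0 \end{bmatrix} \] over $\mathbb{F}_2$, and let $G=\langle\alpha\rangle$, a cyclic group of order $255$. There exists an $LS_2[3](2,3,8)$ large set $\{\mathcal{B}_1,\mathcal{B}_2,\mathcal{B}_3\}$, that is, three pairwise disjoint $2\text{ - }(8,3,21;2)$ designs whose union is the set of all $3$-dimensional subspaces of $\mathbb{F}_2^8$, such that each $\mathcal{B}_i$ admits $G$ as a group of automorphisms, and each $\mathcal{B}_i$ consists of $127$ orbits of $G$ on the set of $3$-dimensional subspaces of $\mathbb{F}_2^8$.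
   Context: Let $\mathbb{F}_q$ be the finite field with $q$ elements and $V=\mathbb{F}_q^n$ (column vectors). A $k$-subspace is a $k$-dimensional linear subspace. A (simple) $t\text{ - }(n,k,\lambda;q)$ design is a set $\mathcal{B}$ of $k$-subspaces of $V$ such that each $t$-subspace of $V$ is contained in exactly $\lambda$ members of $\mathcal{B}$. An $LS_q[N](t,k,n)$ large set is a set of $N$ pairwise disjoint $t\text{ - }(n,k,\lambda;q)$ designs whose union is the set of all $k$-subspaces of $V$. The group $\mathrm{GL}(n,q)$ acts on the set of $k$-subspaces by left multiplication, $\alpha K=\{\alpha x\mid x\in K\}$, and on sets of $k$-subspaces by $\alpha\mathcal{B}=\{\alpha K\mid K\in\mathcal{B}\}$. A design $\mathcal{B}$ admits a subgroup $G\le\mathrm{GL}(n,q)$ as a group of automorphisms if $\alpha\mathcal{B}=\mathcal{B}$ for all $\alpha\in G$. -}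

module Defs where

open import Algebra.Bundles using (Group)
open import Data.Bool.Base using (Bool; true; false; _∧_; _xor_)
open import Data.Bool.Properties
  using (xor-assoc; xor-comm; xor-identityˡ; xor-identityʳ;
         ∧-assoc; ∧-zeroʳ; ∧-identityʳ; ∧-distribˡ-xor; ∧-distribʳ-xor)
open import Data.Fin.Base using (Fin)
open import Data.Nat.Base using (ℕ; zero; suc)
open import Data.Product using (Σ; ∃-syntax; _×_; _,_; proj₁)
open import Data.Vec.Base using (Vec; []; _∷_; map; zipWith; replicate; foldr′)
open import Data.Vec.Properties
  using (map-id; map-cong; map-∘; zipWith-assoc; zipWith-comm;
         zipWith-identityˡ; zipWith-identityʳ)
open import Data.Vec.Relation.Unary.All using (All)
open import Function.Base using (_on_)
open import Function.Bundles using (Bijection)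
open import Function.Definitions using (Injective)
open import Level using (Level; 0ℓ; _⊔_) renaming (suc to ℓsuc)
open import Relation.Binary.Bundles using (Setoid)
open import Relation.Binary.Definitions using (_Respects_)
import Relation.Binary.Construct.On as On
open import Relation.Binary.PropositionalEquality
  using (_≡_; _≢_; refl; sym; trans; cong; cong₂; module ≡-Reasoning)
import Relation.Binary.PropositionalEquality.Properties as ≡
open import Relation.Nullary.Negation using (¬_)
open import Relation.Unary using (Pred; _∈_; _⊆_; _≐_; _⊥_; ⋃)
open import Relation.Unary.Properties using (≐-refl; ≐-sym; ≐-trans)

private variable
  k m n p : ℕ

------------------------------------------------------------------------
-- Vectors over 𝔽₂

-- Addition is _xor_ and multiplication is _∧_, as in
-- Data.Bool.Properties.xor-∧-commutativeRing.
F₂ : Set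
F₂ = Bool

pattern O = false
pattern I = true

V : ℕ → Set
V n = Vec F₂ n

infixl 6 _⊕_
infixr 7 _⊙_

𝟎 : V n
𝟎 = replicate _ O

_⊕_ : V n → V n → V n
_⊕_ = zipWith _xor_

_⊙_ : F₂ → V n → V n
c ⊙ v = map (c ∧_) v

_·_ : V n → V n → F₂
u · v = foldr′ _xor_ O (zipWith _∧_ u v)

lincomb : Vec F₂ m → Vec (V n) m → V n
lincomb []       []       = 𝟎
lincomb (c ∷ cs) (v ∷ vs) = c ⊙ v ⊕ lincomb cs vs

⊕-interchange : (a b c d : V n) → (a ⊕ b) ⊕ (c ⊕ d) ≡ (a ⊕ c) ⊕ (b ⊕ d)
⊕-interchange a b c d = begin
  (a ⊕ b) ⊕ (c ⊕ d) ≡⟨ assoc a b (c ⊕ d) ⟩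
  a ⊕ (b ⊕ (c ⊕ d)) ≡⟨ cong (a ⊕_) (assoc b c d) ⟨
  a ⊕ ((b ⊕ c) ⊕ d) ≡⟨ cong (λ z → a ⊕ (z ⊕ d)) (zipWith-comm xor-comm b c) ⟩
  a ⊕ ((c ⊕ b) ⊕ d) ≡⟨ cong (a ⊕_) (assoc c b d) ⟩
  a ⊕ (c ⊕ (b ⊕ d)) ≡⟨ assoc a c (b ⊕ d) ⟨
  (a ⊕ c) ⊕ (b ⊕ d) ∎
  where
  open ≡-Reasoning
  assoc : (x y z : V _) → (x ⊕ y) ⊕ z ≡ x ⊕ (y ⊕ z)
  assoc = zipWith-assoc xor-assoc

⊙-distribʳ : ∀ c d (v : V n) → (c xor d) ⊙ v ≡ c ⊙ v ⊕ d ⊙ v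
⊙-distribʳ c d []      = refl
⊙-distribʳ c d (x ∷ v) = cong₂ _∷_ (∧-distribʳ-xor x c d) (⊙-distribʳ c d v)

⊙-distribˡ : ∀ c (u v : V n) → c ⊙ (u ⊕ v) ≡ c ⊙ u ⊕ c ⊙ v
⊙-distribˡ c []      []      = refl
⊙-distribˡ c (x ∷ u) (y ∷ v) = cong₂ _∷_ (∧-distribˡ-xor c x y) (⊙-distribˡ c u v)

⊙-assoc : ∀ c d (v : V n) → (c ∧ d) ⊙ v ≡ c ⊙ d ⊙ v
⊙-assoc c d []      = refl
⊙-assoc c d (x ∷ v) = cong₂ _∷_ (∧-assoc c d x) (⊙-assoc c d v)

O⊙ : (v : V n) → O ⊙ v ≡ 𝟎
O⊙ []      = refl
O⊙ (x ∷ v) = cong (O ∷_) (O⊙ v)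

⊙𝟎 : ∀ c → c ⊙ 𝟎 {n} ≡ 𝟎
⊙𝟎 {zero}  c = refl
⊙𝟎 {suc n} c = cong₂ _∷_ (∧-zeroʳ c) (⊙𝟎 c)

lincomb-𝟎 : (vs : Vec (V n) m) → lincomb 𝟎 vs ≡ 𝟎
lincomb-𝟎 []       = refl
lincomb-𝟎 (v ∷ vs) = trans (cong₂ _⊕_ (O⊙ v) (lincomb-𝟎 vs))
                           (zipWith-identityˡ xor-identityˡ 𝟎)

lincomb-⊕ : ∀ (c d : V m) (vs : Vec (V n) m) →
            lincomb (c ⊕ d) vs ≡ lincomb c vs ⊕ lincomb d vs
lincomb-⊕ []      []      []       = sym (zipWith-identityˡ xor-identityˡ 𝟎)
lincomb-⊕ (a ∷ c) (b ∷ d) (v ∷ vs) =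
  trans (cong₂ _⊕_ (⊙-distribʳ a b v) (lincomb-⊕ c d vs))
        (⊕-interchange (a ⊙ v) (b ⊙ v) (lincomb c vs) (lincomb d vs))

lincomb-⊙ : ∀ a (c : V m) (vs : Vec (V n) m) →
            lincomb (a ⊙ c) vs ≡ a ⊙ lincomb c vs
lincomb-⊙ a []      []       = sym (⊙𝟎 a)
lincomb-⊙ a (b ∷ c) (v ∷ vs) =
  trans (cong₂ _⊕_ (⊙-assoc a b v) (lincomb-⊙ a c vs))
        (sym (⊙-distribˡ a (b ⊙ v) (lincomb c vs)))

------------------------------------------------------------------------
-- Matrices and the general linear group

-- A vector of m rows.
Matrix : ℕ → ℕ → Set
Matrix m n = Vec (V n) m

infixr 7 _*ᵥ_
infixl 7 _*ₘ_

_*ᵥ_ : Matrix m n → V n → V m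
M *ᵥ x = map (_· x) M

-- Row i of M *ₘ N is Σⱼ Mᵢⱼ Nⱼ, where Nⱼ is row j of N.
_*ₘ_ : Matrix m n → Matrix n p → Matrix m p
M *ₘ N = map (λ r → lincomb r N) M

1ₘ : Matrix n n
1ₘ {zero}  = []
1ₘ {suc n} = (I ∷ 𝟎) ∷ map (O ∷_) 1ₘ

lincomb-lincomb : (r : V m) (M : Matrix m n) (N : Matrix n p) →
                  lincomb (lincomb r M) N ≡ lincomb r (M *ₘ N)
lincomb-lincomb []      []      N = lincomb-𝟎 N
lincomb-lincomb (c ∷ r) (v ∷ M) N =
  trans (lincomb-⊕ (c ⊙ v) (lincomb r M) N)
        (cong₂ _⊕_ (lincomb-⊙ c v N) (lincomb-lincomb r M N))

lincomb-O∷ : (r : V m) (M : Matrix m n) →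
             lincomb r (map (O ∷_) M) ≡ O ∷ lincomb r M
lincomb-O∷ []      []      = refl
lincomb-O∷ (c ∷ r) (v ∷ M) =
  trans (cong ((c ⊙ (O ∷ v)) ⊕_) (lincomb-O∷ r M))
        (cong (_∷ (c ⊙ v ⊕ lincomb r M)) (trans (xor-identityʳ _) (∧-zeroʳ c)))

lincomb-1ₘ : (r : V n) → lincomb r 1ₘ ≡ r
lincomb-1ₘ []      = refl
lincomb-1ₘ (c ∷ r) =
  trans (cong ((c ⊙ (I ∷ 𝟎)) ⊕_) (lincomb-O∷ r 1ₘ))
        (cong₂ _∷_ (trans (xor-identityʳ _) (∧-identityʳ c))
                   (trans (cong₂ _⊕_ (⊙𝟎 c) (lincomb-1ₘ r))
                          (zipWith-identityˡ xor-identityˡ r)))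

*ₘ-assoc : ∀ {q} (M : Matrix m n) (N : Matrix n p) (P : Matrix p q) →
           (M *ₘ N) *ₘ P ≡ M *ₘ (N *ₘ P)
*ₘ-assoc M N P = trans (sym (map-∘ (λ r → lincomb r P) (λ r → lincomb r N) M))
                       (map-cong (λ r → lincomb-lincomb r N P) M)

*ₘ-identityˡ : (M : Matrix m n) → 1ₘ *ₘ M ≡ M
*ₘ-identityˡ []      = refl
*ₘ-identityˡ (v ∷ M) = cong₂ _∷_ head tail
  where
  I⊙ : (v : V p) → I ⊙ v ≡ v
  I⊙ = map-id
  head : lincomb (I ∷ 𝟎) (v ∷ M) ≡ v
  head = trans (cong₂ _⊕_ (I⊙ v) (lincomb-𝟎 M)) (zipWith-identityʳ xor-identityʳ v)
  tail : map (λ r → lincomb r (v ∷ M)) (map (O ∷_) 1ₘ) ≡ M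
  tail = trans (sym (map-∘ _ (O ∷_) 1ₘ))
        (trans (map-cong (λ r → trans (cong (_⊕ lincomb r M) (O⊙ v))
                                      (zipWith-identityˡ xor-identityˡ _)) 1ₘ)
               (*ₘ-identityˡ M))

*ₘ-identityʳ : (M : Matrix m n) → M *ₘ 1ₘ ≡ M
*ₘ-identityʳ M = trans (map-cong lincomb-1ₘ M) (map-id M)

record GL (n : ℕ) : Set where
  field
    mat  : Matrix n n
    mat⁻ : Matrix n n
    invˡ : mat⁻ *ₘ mat ≡ 1ₘ
    invʳ : mat *ₘ mat⁻ ≡ 1ₘ

open GL public

middle : (A B C D : Matrix n n) → B *ₘ C ≡ 1ₘ → A *ₘ D ≡ 1ₘ →
         (A *ₘ B) *ₘ (C *ₘ D) ≡ 1ₘ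
middle A B C D BC AD = begin
  (A *ₘ B) *ₘ (C *ₘ D) ≡⟨ *ₘ-assoc A B (C *ₘ D) ⟩
  A *ₘ (B *ₘ (C *ₘ D)) ≡⟨ cong (A *ₘ_) (*ₘ-assoc B C D) ⟨
  A *ₘ ((B *ₘ C) *ₘ D) ≡⟨ cong (λ z → A *ₘ (z *ₘ D)) BC ⟩
  A *ₘ (1ₘ *ₘ D)       ≡⟨ cong (A *ₘ_) (*ₘ-identityˡ D) ⟩
  A *ₘ D               ≡⟨ AD ⟩
  1ₘ                   ∎
  where open ≡-Reasoning

inverse-unique : (A B C : Matrix n n) → A *ₘ B ≡ 1ₘ → B *ₘ C ≡ 1ₘ → A ≡ C
inverse-unique A B C AB BC = begin
  A              ≡⟨ *ₘ-identityʳ A ⟨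
  A *ₘ 1ₘ        ≡⟨ cong (A *ₘ_) BC ⟨
  A *ₘ (B *ₘ C)  ≡⟨ *ₘ-assoc A B C ⟨
  (A *ₘ B) *ₘ C  ≡⟨ cong (_*ₘ C) AB ⟩
  1ₘ *ₘ C        ≡⟨ *ₘ-identityˡ C ⟩
  C              ∎
  where open ≡-Reasoning

GL-group : ℕ → Group 0ℓ 0ℓ
GL-group n = record
  { Carrier = GL n
  ; _≈_     = _≡_ on mat
  ; _∙_     = λ g h → record
    { mat  = mat g *ₘ mat h
    ; mat⁻ = mat⁻ h *ₘ mat⁻ g
    ; invˡ = middle (mat⁻ h) (mat⁻ g) (mat g) (mat h) (invˡ g) (invˡ h)
    ; invʳ = middle (mat g) (mat h) (mat⁻ h) (mat⁻ g) (invʳ h) (invʳ g)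
    }
  ; ε       = record { mat = 1ₘ ; mat⁻ = 1ₘ
                     ; invˡ = *ₘ-identityˡ 1ₘ ; invʳ = *ₘ-identityˡ 1ₘ }
  ; _⁻¹     = λ g → record { mat = mat⁻ g ; mat⁻ = mat g ; invˡ = invʳ g ; invʳ = invˡ g }
  ; isGroup = record
    { isMonoid = record
      { isSemigroup = record
        { isMagma = record
          { isEquivalence = On.isEquivalence mat ≡.isEquivalence
          ; ∙-cong        = cong₂ _*ₘ_
          }
        ; assoc = λ g h k → *ₘ-assoc (mat g) (mat h) (mat k)
        }
      ; identity = (λ g → *ₘ-identityˡ (mat g)) , (λ g → *ₘ-identityʳ (mat g))
      }
    ; inverse = invˡ , invʳ
    ; ⁻¹-cong = λ {g} {h} eq →
        inverse-unique (mat⁻ g) (mat g) (mat⁻ h) (invˡ g)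
          (trans (cong (_*ₘ mat⁻ h) eq) (invʳ h))
    }
  }

-- The subgroup of GL(n,2) generated by a.
module _ {n : ℕ} where
  open Group (GL-group n) using (_≈_; _∙_; ε; _⁻¹)

  data ⟨_⟩ (a : GL n) : Pred (GL n) 0ℓ where
    gen  : a ∈ ⟨ a ⟩
    unit : ε ∈ ⟨ a ⟩
    mul  : ∀ {g h} → g ∈ ⟨ a ⟩ → h ∈ ⟨ a ⟩ → g ∙ h ∈ ⟨ a ⟩
    inv  : ∀ {g} → g ∈ ⟨ a ⟩ → g ⁻¹ ∈ ⟨ a ⟩
    resp : ∀ {g h} → g ≈ h → g ∈ ⟨ a ⟩ → h ∈ ⟨ a ⟩

------------------------------------------------------------------------
-- Cardinality of a subset of a setoid, counted up to setoid equality

private variable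
  c ℓ ℓ′ : Level

subsetoid : (S : Setoid c ℓ) → Pred (Setoid.Carrier S) ℓ′ → Setoid (c ⊔ ℓ′) ℓ
subsetoid S P = On.setoid {B = Σ (Setoid.Carrier S) P} S proj₁

HasCardinality : (S : Setoid c ℓ) → Pred (Setoid.Carrier S) ℓ′ → ℕ → Set (c ⊔ ℓ ⊔ ℓ′)
HasCardinality S P N = Bijection (≡.setoid (Fin N)) (subsetoid S P)

------------------------------------------------------------------------
-- Subspaces

record IsSubspace (W : Pred (V n) 0ℓ) : Set where
  field
    𝟎-mem    : 𝟎 ∈ W
    ⊕-closed : ∀ {u v} → u ∈ W → v ∈ W → u ⊕ v ∈ W
    ⊙-closed : ∀ c {v} → v ∈ W → c ⊙ v ∈ W

record Basis (k : ℕ) (W : Pred (V n) 0ℓ) : Set where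
  field
    vectors     : Vec (V n) k
    members     : All W vectors
    independent : ∀ cs → lincomb cs vectors ≡ 𝟎 → cs ≡ 𝟎
    spanning    : ∀ {w} → w ∈ W → ∃[ cs ] lincomb cs vectors ≡ w

-- The chosen basis only witnesses the dimension: k-subspaces are compared
-- with _≃_ below, as sets of vectors.
record Subspace (k n : ℕ) : Set₁ where
  field
    carrier    : Pred (V n) 0ℓ
    isSubspace : IsSubspace carrier
    basis      : Basis k carrier

open Subspace public using (carrier)

infix 4 _≃_

_≃_ : Subspace k n → Subspace k n → Set
K ≃ K′ = carrier K ≐ carrier K′

subspaceSetoid : (k n : ℕ) → Setoid (ℓsuc 0ℓ) 0ℓ
subspaceSetoid k n = record
  { Carrier       = Subspace k n
  ; _≈_           = _≃_
  ; isEquivalence = record { refl = ≐-refl ; sym = ≐-sym ; trans = ≐-trans }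
  }

------------------------------------------------------------------------
-- Designs and large sets

-- A set of k-subspaces is a predicate on Subspace k n respecting _≃_.
record IsDesign (t n k lam : ℕ) (B : Pred (Subspace k n) 0ℓ) : Set₁ where
  field
    respects : B Respects _≃_
    balanced : (T : Subspace t n) →
               HasCardinality (subspaceSetoid k n)
                 (λ K → K ∈ B × carrier T ⊆ carrier K) lam

-- lam is the common index of the N designs; it is determined by the other
-- parameters, but is given explicitly.
record IsLargeSet (N t k n lam : ℕ) (B : Fin N → Pred (Subspace k n) 0ℓ) : Set₁ where
  field
    designs  : ∀ i → IsDesign t n k lam (B i)
    distinct : Injective _≡_ _≐_ B
    disjoint : ∀ {i j} → i ≢ j → B i ⊥ B j
    covering : ∀ K → K ∈ ⋃ (Fin N) B

------------------------------------------------------------------------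
-- The action of GL(n,2)

-- gW = { gx | x ∈ W }
image : GL n → Pred (V n) 0ℓ → Pred (V n) 0ℓ
image g W y = ∃[ x ] (x ∈ W × y ≡ mat g *ᵥ x)

-- gB = { gK | K ∈ B }
imageSet : GL n → Pred (Subspace k n) 0ℓ → Pred (Subspace k n) (ℓsuc 0ℓ)
imageSet g B L = ∃[ K ] (K ∈ B × carrier L ≐ image g (carrier K))

AdmitsAutomorphisms : Pred (GL n) 0ℓ → Pred (Subspace k n) 0ℓ → Set₁
AdmitsAutomorphisms G B = ∀ {g} → g ∈ G → imageSet g B ≐ B

Orbit : Pred (GL n) 0ℓ → Subspace k n → Pred (Subspace k n) 0ℓ
Orbit G K L = ∃[ g ] (g ∈ G × carrier L ≐ image g (carrier K))

-- B is the union of m distinct G-orbits.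
record ConsistsOfOrbits (G : Pred (GL n) 0ℓ) (m : ℕ) (B : Pred (Subspace k n) 0ℓ) : Set₁ where
  field
    rep      : Fin m → Subspace k n
    distinct : ∀ {i j} → i ≢ j → ¬ (Orbit G (rep i) ≐ Orbit G (rep j))
    union    : B ≐ ⋃ (Fin m) (λ i → Orbit G (rep i))

------------------------------------------------------------------------
-- The generator

α : GL 8
α = record
  { mat  = (O ∷ O ∷ O ∷ O ∷ O ∷ O ∷ O ∷ I ∷ [])
         ∷ (I ∷ O ∷ O ∷ O ∷ O ∷ O ∷ O ∷ O ∷ [])
         ∷ (O ∷ I ∷ O ∷ O ∷ O ∷ O ∷ O ∷ I ∷ [])
         ∷ (O ∷ O ∷ I ∷ O ∷ O ∷ O ∷ O ∷ I ∷ [])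
         ∷ (O ∷ O ∷ O ∷ I ∷ O ∷ O ∷ O ∷ I ∷ [])
         ∷ (O ∷ O ∷ O ∷ O ∷ I ∷ O ∷ O ∷ O ∷ [])
         ∷ (O ∷ O ∷ O ∷ O ∷ O ∷ I ∷ O ∷ O ∷ [])
         ∷ (O ∷ O ∷ O ∷ O ∷ O ∷ O ∷ I ∷ O ∷ [])
         ∷ []
  ; mat⁻ = (O ∷ I ∷ O ∷ O ∷ O ∷ O ∷ O ∷ O ∷ [])
         ∷ (I ∷ O ∷ I ∷ O ∷ O ∷ O ∷ O ∷ O ∷ [])
         ∷ (I ∷ O ∷ O ∷ I ∷ O ∷ O ∷ O ∷ O ∷ [])
         ∷ (I ∷ O ∷ O ∷ O ∷ I ∷ O ∷ O ∷ O ∷ [])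
         ∷ (O ∷ O ∷ O ∷ O ∷ O ∷ I ∷ O ∷ O ∷ [])
         ∷ (O ∷ O ∷ O ∷ O ∷ O ∷ O ∷ I ∷ O ∷ [])
         ∷ (O ∷ O ∷ O ∷ O ∷ O ∷ O ∷ O ∷ I ∷ [])
         ∷ (I ∷ O ∷ O ∷ O ∷ O ∷ O ∷ O ∷ O ∷ [])
         ∷ []
  ; invˡ = refl
  ; invʳ = refl
  }

G : Pred (GL 8) 0ℓ
G = ⟨ α ⟩

{-# OPTIONS --safe #-}

-- The vector space is the field 𝔽₂₅₆ with primitive element α, so G is a Singer
-- cycle and nonzero vectors are the powers αᵏ, handled through a table of
-- discrete logarithms.  G has 43 orbits on planes and 381 orbits, all regular,
-- on 3-subspaces; the 381 orbits are split into three classes of 127.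
--
-- Every plane is a translate of one of 43 planes with basis (1,0,a), (0,1,b),
-- and the 3-subspaces containing such a plane are obtained by adding (0,0,y)
-- for one of the 63 nonzero y.  A table names for each of them the orbit and
-- the power of α that carries the orbit representative to it, and shows that
-- each class occurs 21 times.  Representatives ⟨1, αᵃ, αᵇ⟩ are chosen with
-- (a , b) lexicographically least in the orbit, which makes the orbits distinct.

module Submission where

open import Defs
open import Algebra.Bundles using (Group)
open import Data.Bool.Base using (Bool; true; false; _∧_; _xor_)
import Data.Bool.Properties as Bool
open import Data.Empty using (⊥)
open import Data.Fin.Base using (Fin; zero; suc; toℕ; combine)
import Data.Fin.Properties as Fin
open import Data.List.Base as List using (List)
open import Data.List.Membership.Propositional using () renaming (_∈_ to _∈ˡ_)
import Data.List.Membership.Propositional.Properties as List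
import Data.List.Relation.Unary.All as ListAll
import Data.List.Relation.Unary.AllPairs as ListAllPairs
open import Data.List.Relation.Unary.Any as Any using (here)
import Data.List.Relation.Unary.Any.Properties as Any
import Data.List.Relation.Unary.Unique.Propositional as List
import Data.List.Relation.Unary.Unique.Propositional.Properties as UniqueList
open import Data.Nat.Base using (ℕ; zero; suc; _+_; _*_; _∸_; _<_; _≤_; _/_; _%_)
open import Data.Nat.DivMod
  using (_mod_; m≡m%n+[m/n]*n; m%n<n; m%n%n≡m%n; [m+n]%n≡m%n; m<n⇒m%n≡m; %-distribˡ-+)
import Data.Nat.Properties as ℕ
open import Data.Nat.Solver using (module +-*-Solver)
open import Data.Product using (Σ-syntax; ∃-syntax; ∃; _×_; _,_; proj₁; proj₂)
import Data.Product.Properties as Product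
open import Data.Sum.Base using (_⊎_; inj₁; inj₂)
open import Data.Vec.Base using (Vec; []; _∷_; map; lookup; take; drop; tail)
import Data.Vec.Properties as Vec
open import Data.Vec.Relation.Unary.All as All using (All; []; _∷_)
import Data.Vec.Relation.Unary.All.Properties as All
import Data.Vec.Relation.Unary.AllPairs as AllPairs
open import Data.Vec.Relation.Unary.Unique.Propositional using (Unique)
import Data.Vec.Relation.Unary.Unique.Propositional.Properties as Unique
open import Function.Base using (_∘_)
open import Function.Definitions using (Injective)
open import Level using (0ℓ)
open import Relation.Binary.PropositionalEquality
  using (_≡_; _≢_; refl; sym; trans; cong; cong₂; subst; module ≡-Reasoning)
open import Relation.Nullary.Decidable
  using (Dec; yes; no; map′; toWitness; ¬?; _×-dec_; _⊎-dec_; _→-dec_)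
open import Relation.Nullary.Negation using (contradiction)
open import Relation.Unary using (Pred; Decidable; _∈_; _⊆_; _≐_; ⋃)
open import Relation.Unary.Properties using (≐-refl; ≐-sym; ≐-trans)

open Subspace using (isSubspace; basis)
open Basis using (vectors; members; independent; spanning)

-- Subspaces are predicates on vectors, so they cannot be compared by evaluation. A table entry
-- certifies only that some αᵏ maps a few basis vectors into a given span, an addition of logarithms
-- modulo 255; equal dimension then turns the inclusion into an equality. Since `G` preserves each
-- class, the number of blocks above a plane is constant along the orbit of the plane. One plane per
-- orbit thus suffices, and 21 is a third of the 63 extensions. The table shows that an extension
-- lies in its named class. The count also requires that it lies in no other class, so it rests on
-- the distinctness of all 381 orbits. Minimality is tested for each representative by itself,
-- against the 168 ordered bases of 𝔽₂³, so that no two orbits have to be compared: a common orbit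
-- would force equal pairs (a , b).

private variable
  A : Set
  k m n p : ℕ

-- Linear algebra over 𝔽₂

⊕-identityˡ : (v : V n) → 𝟎 ⊕ v ≡ v
⊕-identityˡ = Vec.zipWith-identityˡ Bool.xor-identityˡ

⊕-identityʳ : (v : V n) → v ⊕ 𝟎 ≡ v
⊕-identityʳ = Vec.zipWith-identityʳ Bool.xor-identityʳ

⊕-assoc : (u v w : V n) → (u ⊕ v) ⊕ w ≡ u ⊕ (v ⊕ w)
⊕-assoc = Vec.zipWith-assoc Bool.xor-assoc

⊕-self : (v : V n) → v ⊕ v ≡ 𝟎
⊕-self []      = refl
⊕-self (x ∷ v) = cong₂ _∷_ (Bool.xor-same x) (⊕-self v)

I⊙ : (v : V n) → I ⊙ v ≡ v
I⊙ = Vec.map-id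

·-comm : (u v : V n) → u · v ≡ v · u
·-comm []      []      = refl
·-comm (a ∷ u) (b ∷ v) = cong₂ _xor_ (Bool.∧-comm a b) (·-comm u v)

·-𝟎 : (u : V n) → u · 𝟎 ≡ O
·-𝟎 []      = refl
·-𝟎 (a ∷ u) = cong₂ _xor_ (Bool.∧-zeroʳ a) (·-𝟎 u)

·-⊕ : (u v w : V n) → u · (v ⊕ w) ≡ (u · v) xor (u · w)
·-⊕ []      []      []      = refl
·-⊕ (a ∷ u) (b ∷ v) (c ∷ w) =
  trans (cong₂ _xor_ (Bool.∧-distribˡ-xor a b c) (·-⊕ u v w))
        -- The interchange law for `_xor_` is read off from `⊕-interchange` on vectors with one
        -- entry.
        (Vec.∷-injectiveˡ (⊕-interchange (a ∧ b ∷ []) (a ∧ c ∷ []) (u · v ∷ []) (u · w ∷ [])))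

·-⊙ : ∀ (u : V n) c v → u · (c ⊙ v) ≡ c ∧ (u · v)
·-⊙ u O v = trans (cong (u ·_) (O⊙ v)) (·-𝟎 u)
·-⊙ u I v = cong (u ·_) (I⊙ v)

-- Matrix products are defined by combinations of rows, the action on vectors by dot products. This
-- adjunction links the two and gives `*ₘ-*ᵥ` row by row.
lincomb-· : (r : V m) (N : Matrix m n) (x : V n) → lincomb r N · x ≡ r · (N *ᵥ x)
lincomb-· []      []      x = trans (·-comm 𝟎 x) (·-𝟎 x)
lincomb-· (c ∷ r) (v ∷ N) x = begin
  (c ⊙ v ⊕ lincomb r N) · x             ≡⟨ ·-comm _ x ⟩
  x · (c ⊙ v ⊕ lincomb r N)             ≡⟨ ·-⊕ x (c ⊙ v) (lincomb r N) ⟩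
  (x · (c ⊙ v)) xor (x · lincomb r N)   ≡⟨ cong₂ _xor_ (·-⊙ x c v) (·-comm x _) ⟩
  (c ∧ (x · v)) xor (lincomb r N · x)   ≡⟨ cong₂ _xor_ (cong (c ∧_) (·-comm x v)) (lincomb-· r N x) ⟩
  (c ∧ (v · x)) xor (r · (N *ᵥ x))      ∎
  where open ≡-Reasoning

*ᵥ-⊕ : (M : Matrix m n) (u v : V n) → M *ᵥ (u ⊕ v) ≡ M *ᵥ u ⊕ M *ᵥ v
*ᵥ-⊕ []      u v = refl
*ᵥ-⊕ (r ∷ M) u v = cong₂ _∷_ (·-⊕ r u v) (*ᵥ-⊕ M u v)

*ᵥ-⊙ : ∀ (M : Matrix m n) c v → M *ᵥ (c ⊙ v) ≡ c ⊙ (M *ᵥ v)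
*ᵥ-⊙ []      c v = refl
*ᵥ-⊙ (r ∷ M) c v = cong₂ _∷_ (·-⊙ r c v) (*ᵥ-⊙ M c v)

*ᵥ-𝟎 : (M : Matrix m n) → M *ᵥ 𝟎 ≡ 𝟎
*ᵥ-𝟎 []      = refl
*ᵥ-𝟎 (r ∷ M) = cong₂ _∷_ (·-𝟎 r) (*ᵥ-𝟎 M)

*ᵥ-lincomb : (M : Matrix m n) (c : V k) (vs : Vec (V n) k) →
             M *ᵥ lincomb c vs ≡ lincomb c (map (M *ᵥ_) vs)
*ᵥ-lincomb M []      []       = *ᵥ-𝟎 M
*ᵥ-lincomb M (a ∷ c) (v ∷ vs) =
  trans (*ᵥ-⊕ M (a ⊙ v) (lincomb c vs)) (cong₂ _⊕_ (*ᵥ-⊙ M a v) (*ᵥ-lincomb M c vs))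

*ₘ-*ᵥ : (M : Matrix m n) (N : Matrix n p) (x : V p) → (M *ₘ N) *ᵥ x ≡ M *ᵥ (N *ᵥ x)
*ₘ-*ᵥ M N x = trans (sym (Vec.map-∘ (_· x) (λ r → lincomb r N) M))
                    (Vec.map-cong (λ r → lincomb-· r N x) M)

1ₘ-*ᵥ : (x : V n) → 1ₘ *ᵥ x ≡ x
1ₘ-*ᵥ []      = refl
1ₘ-*ᵥ (a ∷ x) = cong₂ _∷_
  (trans (cong (a xor_) (trans (·-comm 𝟎 x) (·-𝟎 x))) (Bool.xor-identityʳ a))
  (trans (sym (Vec.map-∘ (_· (a ∷ x)) (O ∷_) 1ₘ)) (1ₘ-*ᵥ x))

*ᵥ-cancel : (M N : Matrix n n) → M *ₘ N ≡ 1ₘ → ∀ x → M *ᵥ (N *ᵥ x) ≡ x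
*ᵥ-cancel M N MN x = trans (sym (*ₘ-*ᵥ M N x)) (trans (cong (_*ᵥ x) MN) (1ₘ-*ᵥ x))

*ᵥ-injective : (g : GL n) {x y : V n} → mat g *ᵥ x ≡ mat g *ᵥ y → x ≡ y
*ᵥ-injective g {x} {y} eq =
  trans (sym (*ᵥ-cancel (mat⁻ g) (mat g) (invˡ g) x))
  (trans (cong (mat⁻ g *ᵥ_) eq) (*ᵥ-cancel (mat⁻ g) (mat g) (invˡ g) y))

-- Exhaustive search and tables

-- The search over entries is a parameter: `allBool?` yields a search over vectors, and `allV?` in
-- turn one over matrices.
allVec? : (∀ {P : Pred A 0ℓ} → Decidable P → Dec (∀ x → P x)) →
          ∀ {n} {P : Pred (Vec A n) 0ℓ} → Decidable P → Dec (∀ v → P v)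
allVec? all? {zero}  P? = map′ (λ { p [] → p }) (λ p → p []) (P? [])
allVec? all? {suc n} P? =
  map′ (λ { p (x ∷ v) → p x v }) (λ p x v → p (x ∷ v))
       (all? (λ x → allVec? all? (λ v → P? (x ∷ v))))

allBool? : {P : Pred Bool 0ℓ} → Decidable P → Dec (∀ b → P b)
allBool? P? = map′ (λ { (p , q) false → p ; (p , q) true → q }) (λ p → p false , p true)
                   (P? false ×-dec P? true)

allV? : {P : Pred (V n) 0ℓ} → Decidable P → Dec (∀ v → P v)
allV? = allVec? allBool?

anyV? : ∀ {n} {P : Pred (V n) 0ℓ} → Decidable P → Dec (∃[ v ] P v)
anyV? {zero}  P? = map′ ([] ,_) (λ { ([] , p) → p }) (P? [])
anyV? {suc n} P? =
  map′ (λ { (inj₁ (v , p)) → O ∷ v , p ; (inj₂ (v , p)) → I ∷ v , p })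
       (λ { (O ∷ v , p) → inj₁ (v , p) ; (I ∷ v , p) → inj₂ (v , p) })
       (anyV? (λ v → P? (O ∷ v)) ⊎-dec anyV? (λ v → P? (I ∷ v)))

infix 4 _≟ᵥ_
_≟ᵥ_ : (u v : V n) → Dec (u ≡ v)
_≟ᵥ_ = Vec.≡-dec Bool._≟_

-- A complete binary tree with its leaves indexed by bit vectors, so that a lookup takes one step
-- per bit.
Table : Set → ℕ → Set
Table A zero    = A
Table A (suc n) = Table A n × Table A n

infixl 9 _!_
_!_ : Table A n → V n → A
_!_ {n = zero}  t       []      = t
_!_ {n = suc n} (s , t) (O ∷ v) = s ! v
_!_ {n = suc n} (s , t) (I ∷ v) = t ! v

-- Evaluating f once per vector lets the searches below share its values.
tabulate : (V n → A) → Table A n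
tabulate {zero}  f = f []
tabulate {suc n} f = tabulate (f ∘ (O ∷_)) , tabulate (f ∘ (I ∷_))

tabulate-! : (f : V n → A) (v : V n) → tabulate f ! v ≡ f v
tabulate-! f []      = refl
tabulate-! f (O ∷ v) = tabulate-! (f ∘ (O ∷_)) v
tabulate-! f (I ∷ v) = tabulate-! (f ∘ (I ∷_)) v

allVectors : ∀ n → List (V n)
allVectors zero    = [] List.∷ List.[]
allVectors (suc n) = List.map (O ∷_) (allVectors n) List.++ List.map (I ∷_) (allVectors n)

lookup-injective : {xs : List A} → List.Unique xs →
                   ∀ i j → List.lookup xs i ≡ List.lookup xs j → i ≡ j
lookup-injective (_  ListAllPairs.∷ _) zero    zero    _  = refl
lookup-injective (x∉ ListAllPairs.∷ _) zero    (suc j) eq =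
  contradiction eq (ListAll.lookup x∉ (List.∈-lookup j))
lookup-injective (x∉ ListAllPairs.∷ _) (suc i) zero    eq =
  contradiction (sym eq) (ListAll.lookup x∉ (List.∈-lookup i))
lookup-injective (_  ListAllPairs.∷ u) (suc i) (suc j) eq = cong suc (lookup-injective u i j eq)

-- Filtering an exhaustive list without repetitions leaves every solution of `P` at exactly one
-- position. A length found by evaluation thereby becomes an enumeration by `Fin N`.
enumerate : {P : Pred A 0ℓ} (P? : Decidable P) {xs : List A} → List.Unique xs →
  (∀ x → x ∈ˡ xs) → ∀ {N} → List.length (List.filter P? xs) ≡ N →
  Σ[ f ∈ (Fin N → A) ] (∀ i → P (f i)) × Injective _≡_ _≡_ f × (∀ {x} → P x → ∃[ i ] f i ≡ x)
enumerate P? {xs} unique complete refl =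
  List.lookup ys ,
  (λ i → proj₂ (List.∈-filter⁻ P? {xs = xs} (List.∈-lookup i))) ,
  (λ {i} {j} → lookup-injective (UniqueList.filter⁺ P? unique) i j) ,
  λ {x} px → let x∈ = List.∈-filter⁺ P? (complete x) px in
    Any.index x∈ , sym (Any.lookup-index x∈)
  where ys = List.filter P? xs

allVectors-complete : (v : V n) → v ∈ˡ allVectors n
allVectors-complete []      = here refl
allVectors-complete {suc n} (O ∷ v) = List.∈-++⁺ˡ (List.∈-map⁺ (O ∷_) (allVectors-complete v))
allVectors-complete {suc n} (I ∷ v) =
  List.∈-++⁺ʳ (List.map (O ∷_) (allVectors n)) (List.∈-map⁺ (I ∷_) (allVectors-complete v))

allVectors-unique : ∀ n → List.Unique (allVectors n)
allVectors-unique zero    = ListAll.[] ListAllPairs.∷ ListAllPairs.[]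
allVectors-unique (suc n) = UniqueList.++⁺
  (UniqueList.map⁺ Vec.∷-injectiveʳ (allVectors-unique n))
  (UniqueList.map⁺ Vec.∷-injectiveʳ (allVectors-unique n))
  λ (p , q) → disjoint (List.∈-map⁻ (O ∷_) p) (List.∈-map⁻ (I ∷_) q)
  where
  disjoint : ∀ {v : V (suc n)} → (∃[ u ] u ∈ˡ allVectors n × v ≡ O ∷ u) →
             (∃[ u ] u ∈ˡ allVectors n × v ≡ I ∷ u) → ⊥
  disjoint (_ , _ , refl) (_ , _ , ())

-- Subspaces

Independent : Vec (V n) k → Set
Independent vs = ∀ c → lincomb c vs ≡ 𝟎 → c ≡ 𝟎

independent? : Decidable (Independent {n} {k})
independent? vs = allV? (λ c → (lincomb c vs ≟ᵥ 𝟎) →-dec (c ≟ᵥ 𝟎))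

initial-independent : (u v w : V n) → Independent (u ∷ v ∷ w ∷ []) → Independent (u ∷ v ∷ [])
initial-independent u v w ind (c ∷ d ∷ []) eq = cong (take 2) (ind (c ∷ d ∷ O ∷ []) (trans
  (cong (λ z → c ⊙ u ⊕ (d ⊙ v ⊕ z)) (trans (⊕-identityʳ (O ⊙ w)) (O⊙ w))) eq))

-- For square matrices independence implies spanning. Fixing `k` turns this piece of dimension
-- theory into a finite search, which is run for the two dimensions that occur, 2 and 3.
Complete : ℕ → Set
Complete k = (M : Matrix k k) → Independent M → ∀ d → ∃[ c ] lincomb c M ≡ d

complete? : ∀ k → Dec (Complete k)
complete? k = allVec? allV? (λ M →
  independent? M →-dec allV? (λ d → anyV? (λ c → lincomb c M ≟ᵥ d)))

abstract
  complete-2 : Complete 2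
  complete-2 = toWitness {a? = complete? 2} _

  complete-3 : Complete 3
  complete-3 = toWitness {a? = complete? 3} _

Span : Vec (V n) k → Pred (V n) 0ℓ
Span vs w = ∃[ c ] lincomb c vs ≡ w

span-isSubspace : (vs : Vec (V n) k) → IsSubspace (Span vs)
span-isSubspace vs = record
  { 𝟎-mem    = 𝟎 , lincomb-𝟎 vs
  ; ⊕-closed = λ { (c , refl) (d , refl) → c ⊕ d , lincomb-⊕ c d vs }
  ; ⊙-closed = λ { a (c , refl) → a ⊙ c , lincomb-⊙ a c vs }
  }

-- The rows of `1ₘ` serve as coefficient vectors, because `1ₘ *ₘ vs` is `vs`.
span-members : (vs : Vec (V n) k) → All (Span vs) vs
span-members vs = subst (All (Span vs)) (*ₘ-identityˡ vs)
                        (All.map⁺ (All.universal (λ r → r , refl) 1ₘ))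

lincomb-closed : {W : Pred (V n) 0ℓ} → IsSubspace W →
                 {vs : Vec (V n) k} → All (_∈ W) vs → ∀ c → lincomb c vs ∈ W
lincomb-closed W []       []      = IsSubspace.𝟎-mem W
lincomb-closed W (v ∷ vs) (a ∷ c) =
  IsSubspace.⊕-closed W (IsSubspace.⊙-closed W a v) (lincomb-closed W vs c)

Span⊆ : {W : Pred (V n) 0ℓ} → IsSubspace W →
        {vs : Vec (V n) k} → All (_∈ W) vs → Span vs ⊆ W
Span⊆ W vs (c , refl) = lincomb-closed W vs c

span : (vs : Vec (V n) k) → Independent vs → Subspace k n
span vs ind = record
  { carrier    = Span vs
  ; isSubspace = span-isSubspace vs
  ; basis      = record { vectors = vs ; members = span-members vs
                        ; independent = ind ; spanning = λ w → w }
  }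

⊆Span : (K : Subspace k n) → carrier K ⊆ Span (vectors (basis K))
⊆Span K = spanning (basis K)

coefficients : {us : Vec (V n) m} {vs : Vec (V n) k} → All (Span vs) us →
               Σ[ M ∈ Matrix m k ] M *ₘ vs ≡ us
coefficients []              = [] , refl
coefficients ((c , eq) ∷ us) = let M , eqs = coefficients us in c ∷ M , cong₂ _∷_ eq eqs

-- The matrix `M` writes the basis of `U` in terms of that of `W`. A relation among its rows would
-- be a relation among the basis vectors of `U`, so the rows are independent; by `Complete k` they
-- then reach the coordinates of every `w` in `W`.
⊆⇒⊇ : Complete k → (U W : Subspace k n) → carrier U ⊆ carrier W → carrier W ⊆ carrier U
⊆⇒⊇ {k} complete U W U⊆W {w} w∈W =
  subst (carrier U) eq (lincomb-closed (isSubspace U) (members (basis U)) c)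
  where
  us = vectors (basis U)
  ws = vectors (basis W)
  M : Matrix k k
  M = proj₁ (coefficients (All.map (λ u → spanning (basis W) (U⊆W u)) (members (basis U))))
  M*ws≡us : M *ₘ ws ≡ us
  M*ws≡us = proj₂ (coefficients (All.map (λ u → spanning (basis W) (U⊆W u)) (members (basis U))))
  lincomb-M : ∀ c → lincomb (lincomb c M) ws ≡ lincomb c us
  lincomb-M c = trans (lincomb-lincomb c M ws) (cong (lincomb c) M*ws≡us)
  M-independent : Independent M
  M-independent c cM≡𝟎 = independent (basis U) c
    (trans (sym (lincomb-M c)) (trans (cong (λ d → lincomb d ws) cM≡𝟎) (lincomb-𝟎 ws)))
  d = proj₁ (spanning (basis W) w∈W)
  c = proj₁ (complete M M-independent d)
  eq : lincomb c us ≡ w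
  eq = trans (sym (lincomb-M c))
       (trans (cong (λ d → lincomb d ws) (proj₂ (complete M M-independent d)))
              (proj₂ (spanning (basis W) w∈W)))

⊆⇒≐ : Complete k → (U W : Subspace k n) → carrier U ⊆ carrier W → carrier U ≐ carrier W
⊆⇒≐ complete U W U⊆W = (λ {x} → U⊆W {x}) , (λ {x} → ⊆⇒⊇ complete U W U⊆W {x})

translate : GL n → Subspace k n → Subspace k n
translate g K = record
  { carrier    = image g (carrier K)
  ; isSubspace = record
    { 𝟎-mem    = 𝟎 , 𝟎-mem , sym (*ᵥ-𝟎 (mat g))
    ; ⊕-closed = λ { (x , x∈K , refl) (y , y∈K , refl) →
                     x ⊕ y , ⊕-closed x∈K y∈K , sym (*ᵥ-⊕ (mat g) x y) }
    ; ⊙-closed = λ { c (x , x∈K , refl) → c ⊙ x , ⊙-closed c x∈K , sym (*ᵥ-⊙ (mat g) c x) }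
    }
  ; basis      = record
    { vectors     = map (mat g *ᵥ_) vs
    ; members     = All.map⁺ (All.map (λ x∈K → _ , x∈K , refl) (members (basis K)))
    ; independent = λ c eq → independent (basis K) c (*ᵥ-injective g
        (trans (*ᵥ-lincomb (mat g) c vs) (trans eq (sym (*ᵥ-𝟎 (mat g))))))
    ; spanning    = λ { (x , x∈K , refl) → let c , eq = spanning (basis K) x∈K in
        c , trans (sym (*ᵥ-lincomb (mat g) c vs)) (cong (mat g *ᵥ_) eq) }
    }
  }
  where
  open IsSubspace (isSubspace K)
  vs = vectors (basis K)

-- Images and orbits

module _ {n : ℕ} where
  open Group (GL-group n) using (_≈_; _∙_; ε; _⁻¹)

  image-mono : ∀ g {U W : Pred (V n) 0ℓ} → U ⊆ W → image g U ⊆ image g W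
  image-mono g U⊆W (x , x∈U , eq) = x , U⊆W x∈U , eq

  image-cong : ∀ g {U W : Pred (V n) 0ℓ} → U ≐ W → image g U ≐ image g W
  image-cong g {U} {W} (⊆ , ⊇) = image-mono g {U} {W} ⊆ , image-mono g {W} {U} ⊇

  image-resp : ∀ g h {W : Pred (V n) 0ℓ} → g ≈ h → image g W ≐ image h W
  image-resp g h eq = (λ { (x , x∈W , refl) → x , x∈W , cong (_*ᵥ x) eq })
                    , (λ { (x , x∈W , refl) → x , x∈W , cong (_*ᵥ x) (sym eq) })

  image-ε : ∀ {W : Pred (V n) 0ℓ} → image ε W ≐ W
  image-ε {W} = (λ { (x , x∈W , refl) → subst W (sym (1ₘ-*ᵥ x)) x∈W })
              , (λ {x} x∈W → x , x∈W , sym (1ₘ-*ᵥ x))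

  image-∙ : ∀ g h {W : Pred (V n) 0ℓ} → image (g ∙ h) W ≐ image g (image h W)
  image-∙ g h = (λ { (x , x∈W , refl) → mat h *ᵥ x , (x , x∈W , refl) , *ₘ-*ᵥ (mat g) (mat h) x })
              , (λ { (_ , (x , x∈W , refl) , refl) → x , x∈W , sym (*ₘ-*ᵥ (mat g) (mat h) x) })

  -- Applied to `g ⁻¹` and `≐-refl` this yields `W ≐ image g (image (g ⁻¹) W)`, since `(g ⁻¹) ⁻¹` is
  -- definitionally `g`. In this form it undoes translations below.
  image-⁻¹ : ∀ g {U W : Pred (V n) 0ℓ} → U ≐ image g W → W ≐ image (g ⁻¹) U
  image-⁻¹ g {U} {W} eq =
    ≐-trans (≐-sym (image-ε {W})) (≐-trans (≐-sym (image-resp (g ⁻¹ ∙ g) ε {W} (invˡ g)))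
      (≐-trans (image-∙ (g ⁻¹) g {W}) (image-cong (g ⁻¹) (≐-sym eq))))

  module _ {a : GL n} where

    orbit-sym : (K L : Subspace k n) → Orbit ⟨ a ⟩ K L → Orbit ⟨ a ⟩ L K
    orbit-sym K L (g , g∈G , eq) = g ⁻¹ , inv g∈G , image-⁻¹ g eq

    orbit-trans : (K L M : Subspace k n) → Orbit ⟨ a ⟩ K L → Orbit ⟨ a ⟩ L M → Orbit ⟨ a ⟩ K M
    orbit-trans K L M (g , g∈G , L≐) (h , h∈G , M≐) =
      h ∙ g , mul h∈G g∈G ,
      ≐-trans M≐ (≐-trans (image-cong h L≐) (≐-sym (image-∙ h g)))

    orbit-refl : (K L : Subspace k n) → carrier L ≐ carrier K → Orbit ⟨ a ⟩ K L
    orbit-refl K L eq = ε , unit , ≐-trans eq (≐-sym image-ε)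

image-cancel : (g : GL n) {U W : Pred (V n) 0ℓ} → image g U ⊆ image g W → U ⊆ W
image-cancel g {U} {W} sub {x} x∈U with sub (x , x∈U , refl)
... | y , y∈W , eq = subst W (sym (*ᵥ-injective g eq)) y∈W

-- The field 𝔽₂₅₆ and powers of α

-- Multiplication by x modulo x⁸ + x⁴ + x³ + x² + 1, the entries being the coefficients of 1, x,
-- ..., x⁷. As a shift with three corrections it is cheaper to evaluate than the matrix product.
mulα : V 8 → V 8
mulα (a ∷ b ∷ c ∷ d ∷ e ∷ f ∷ g ∷ h ∷ []) =
  h ∷ a ∷ (b xor h) ∷ (c xor h) ∷ (d xor h) ∷ e ∷ f ∷ g ∷ []

exp : ℕ → V 8
exp zero    = I ∷ 𝟎
exp (suc k) = mulα (exp k)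

abstract
  mulα-correct : ∀ v → mulα v ≡ mat α *ᵥ v
  mulα-correct = toWitness {a? = allV? λ v → mulα v ≟ᵥ mat α *ᵥ v} _

  -- The entry at 𝟎 is 255, which is no exponent modulo 255.
  log : V 8 → ℕ
  log v = table ! v
    where
    table : Table ℕ 8
    table =
      ((((((((255 , 7) , (6 , 31)) , ((5 , 55) , (30 , 203))) , (((4 , 227) , (54 , 108)) , ((29 , 242) , (202 , 79))))
      , ((((3 , 103) , (226 , 196)) , ((53 , 144) , (107 , 11))) , (((28 , 17) , (241 , 251)) , ((201 , 132) , (78 , 116)))))
      , (((((2 , 140) , (102 , 183)) , ((225 , 149) , (195 , 156))) , (((52 , 38) , (143 , 41)) , ((106 , 20) , (10 , 230))))
      , ((((27 , 49) , (16 , 127)) , ((240 , 220) , (250 , 122))) , (((200 , 35) , (131 , 187)) , ((77 , 71) , (115 , 168))))))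
      , ((((((1 , 192) , (139 , 67)) , ((101 , 209) , (182 , 95))) , (((224 , 153) , (148 , 59)) , ((194 , 211) , (155 , 213))))
      , ((((51 , 222) , (37 , 73)) , ((142 , 151) , (40 , 22))) , (((105 , 146) , (19 , 134)) , ((9 , 57) , (229 , 244)))))
      , (((((26 , 99) , (48 , 164)) , ((15 , 207) , (126 , 160))) , (((239 , 180) , (219 , 85)) , ((249 , 93) , (121 , 173))))
      , ((((199 , 254) , (34 , 111)) , ((130 , 190) , (186 , 44))) , (((76 , 137) , (70 , 62)) , ((114 , 65) , (167 , 88)))))))
      , (((((((0 , 112) , (191 , 45)) , ((138 , 63) , (66 , 89))) , (((100 , 165) , (208 , 161)) , ((181 , 86) , (94 , 174))))
      , ((((223 , 74) , (152 , 23)) , ((147 , 135) , (58 , 245))) , (((193 , 68) , (210 , 96)) , ((154 , 60) , (212 , 214)))))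
      , (((((50 , 128) , (221 , 123)) , ((36 , 188) , (72 , 169))) , (((141 , 184) , (150 , 157)) , ((39 , 42) , (21 , 231))))
      , ((((104 , 197) , (145 , 12)) , ((18 , 252) , (133 , 117))) , (((8 , 32) , (56 , 204)) , ((228 , 109) , (243 , 80))))))
      , ((((((25 , 247) , (98 , 216)) , ((47 , 91) , (163 , 176))) , (((14 , 119) , (206 , 82)) , ((125 , 171) , (159 , 233))))
      , ((((238 , 237) , (179 , 236)) , ((218 , 178) , (84 , 235))) , (((248 , 217) , (92 , 177)) , ((120 , 83) , (172 , 234)))))
      , (((((198 , 13) , (253 , 118)) , ((33 , 205) , (110 , 81))) , (((129 , 124) , (189 , 170)) , ((185 , 158) , (43 , 232))))
      , ((((75 , 24) , (136 , 246)) , ((69 , 97) , (61 , 215))) , (((113 , 46) , (64 , 90)) , ((166 , 162) , (87 , 175))))))))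

  log-𝟎 : log 𝟎 ≡ 255
  log-𝟎 = refl

  log-exp-0 : log (exp 0) ≡ 0
  log-exp-0 = refl

  log-mulα : ∀ v → v ≢ 𝟎 → log (mulα v) ≡ suc (log v) % 255
  log-mulα = toWitness
    {a? = allV? λ v → ¬? (v ≟ᵥ 𝟎) →-dec (log (mulα v) ℕ.≟ suc (log v) % 255)} _

  exp-log : ∀ v → v ≢ 𝟎 → exp (log v) ≡ v
  exp-log = toWitness {a? = allV? λ v → ¬? (v ≟ᵥ 𝟎) →-dec (exp (log v) ≟ᵥ v)} _

  log<255 : ∀ v → v ≢ 𝟎 → log v < 255
  log<255 = toWitness {a? = allV? λ v → ¬? (v ≟ᵥ 𝟎) →-dec (log v ℕ.<? 255)} _

exp≢𝟎 : ∀ k → exp k ≢ 𝟎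
exp≢𝟎 zero    ()
exp≢𝟎 (suc k) eq = exp≢𝟎 k (*ᵥ-injective α
  (trans (sym (mulα-correct (exp k))) (trans eq (sym (*ᵥ-𝟎 (mat α))))))

log-exp : ∀ k → log (exp k) ≡ k % 255
log-exp zero    = log-exp-0
log-exp (suc k) = begin
  log (mulα (exp k))        ≡⟨ log-mulα (exp k) (exp≢𝟎 k) ⟩
  suc (log (exp k)) % 255   ≡⟨ cong (λ l → suc l % 255) (log-exp k) ⟩
  suc (k % 255) % 255       ≡⟨ %-distribˡ-+ 1 k 255 ⟨
  suc k % 255               ∎
  where open ≡-Reasoning

exp-% : ∀ k → exp (k % 255) ≡ exp k
exp-% k = trans (cong exp (sym (log-exp k))) (exp-log (exp k) (exp≢𝟎 k))

-- A remainder modulo 255 is smaller than the entry 255 at `𝟎`, so the equation itself forces `v` to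
-- be nonzero. A successful lookup therefore always exhibits a power of α.
log≡⇒exp : ∀ v k → log v ≡ k % 255 → v ≡ exp k
log≡⇒exp v k eq = trans (sym (exp-log v v≢𝟎)) (trans (cong exp eq) (exp-% k))
  where
  v≢𝟎 : v ≢ 𝟎
  v≢𝟎 refl = ℕ.<⇒≢ (m%n<n k 255) (trans (sym eq) log-𝟎)

-- The group `G` as the set of powers of α

open Group (GL-group 8) using (_≈_; _∙_; ε; _⁻¹)

abstract
  -- Abstract, since unifying powers with literal exponents would unfold them.
  pow : ℕ → GL 8
  pow zero    = ε
  pow (suc k) = α ∙ pow k

  pow-zero : pow 0 ≈ ε
  pow-zero = refl

  pow-suc : ∀ k → pow (suc k) ≈ α ∙ pow k
  pow-suc k = refl

  pow∈G : ∀ k → pow k ∈ G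
  pow∈G zero    = unit
  pow∈G (suc k) = mul gen (pow∈G k)

  pow-255 : pow 255 ≈ ε
  pow-255 = toWitness {a? = Vec.≡-dec _≟ᵥ_ (mat (pow 255)) (mat ε)} _

pow-+ : ∀ j k → pow (j + k) ≈ pow j ∙ pow k
pow-+ zero    k = sym (trans (cong (_*ₘ mat (pow k)) pow-zero) (*ₘ-identityˡ (mat (pow k))))
pow-+ (suc j) k = begin
  mat (pow (suc (j + k)))                    ≡⟨ pow-suc (j + k) ⟩
  mat α *ₘ mat (pow (j + k))                 ≡⟨ cong (mat α *ₘ_) (pow-+ j k) ⟩
  mat α *ₘ (mat (pow j) *ₘ mat (pow k))      ≡⟨ *ₘ-assoc (mat α) (mat (pow j)) (mat (pow k)) ⟨
  (mat α *ₘ mat (pow j)) *ₘ mat (pow k)      ≡⟨ cong (_*ₘ mat (pow k)) (pow-suc j) ⟨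
  mat (pow (suc j)) *ₘ mat (pow k)           ∎
  where open ≡-Reasoning

pow-*255 : ∀ k → pow (k * 255) ≈ ε
pow-*255 zero    = pow-zero
pow-*255 (suc k) = trans (pow-+ 255 (k * 255))
  (trans (cong₂ _*ₘ_ pow-255 (pow-*255 k)) (*ₘ-identityˡ 1ₘ))

pow-% : ∀ k → pow (k % 255) ≈ pow k
pow-% k = begin
  mat (pow (k % 255))                                  ≡⟨ *ₘ-identityʳ _ ⟨
  mat (pow (k % 255)) *ₘ 1ₘ                            ≡⟨ cong (mat (pow (k % 255)) *ₘ_) (pow-*255 (k / 255)) ⟨
  mat (pow (k % 255)) *ₘ mat (pow (k / 255 * 255))     ≡⟨ pow-+ (k % 255) (k / 255 * 255) ⟨
  mat (pow (k % 255 + k / 255 * 255))                  ≡⟨ cong (mat ∘ pow) (m≡m%n+[m/n]*n k 255) ⟨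
  mat (pow k)                                          ∎
  where open ≡-Reasoning

-- Natural exponents reach inverses too: k + 254 k = 255 k and α²⁵⁵ = 1, so the inverse of αᵏ is the
-- power with exponent 254 k.
G⇒pow : ∀ {g} → g ∈ G → ∃[ k ] g ≈ pow k
G⇒pow gen  = 1 , sym (trans (pow-suc 0) (trans (cong (mat α *ₘ_) pow-zero) (*ₘ-identityʳ (mat α))))
G⇒pow unit = 0 , sym pow-zero
G⇒pow (mul g∈G h∈G) =
  let j , g≈ = G⇒pow g∈G
      k , h≈ = G⇒pow h∈G
  in j + k , trans (cong₂ _*ₘ_ g≈ h≈) (sym (pow-+ j k))
G⇒pow (inv {g} g∈G) =
  let k , g≈ = G⇒pow g∈G
  in k * 254 , inverse-unique (mat⁻ g) (mat g) (mat (pow (k * 254))) (invˡ g)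
       (trans (cong (_*ₘ mat (pow (k * 254))) g≈)
       (trans (sym (pow-+ k (k * 254)))
       (trans (cong (mat ∘ pow) (sym (ℕ.*-suc k 254))) (pow-*255 k))))
G⇒pow (resp g≈h g∈G) = let k , g≈ = G⇒pow g∈G in k , trans (sym g≈h) g≈

pow-exp : ∀ j k → mat (pow j) *ᵥ exp k ≡ exp (j + k)
pow-exp zero    k = trans (cong (_*ᵥ exp k) pow-zero) (1ₘ-*ᵥ (exp k))
pow-exp (suc j) k = begin
  mat (pow (suc j)) *ᵥ exp k            ≡⟨ cong (_*ᵥ exp k) (pow-suc j) ⟩
  (mat α *ₘ mat (pow j)) *ᵥ exp k       ≡⟨ *ₘ-*ᵥ (mat α) (mat (pow j)) (exp k) ⟩
  mat α *ᵥ (mat (pow j) *ᵥ exp k)       ≡⟨ cong (mat α *ᵥ_) (pow-exp j k) ⟩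
  mat α *ᵥ exp (j + k)                  ≡⟨ mulα-correct (exp (j + k)) ⟨
  mulα (exp (j + k))                    ∎
  where open ≡-Reasoning

G-cardinality : HasCardinality (Group.setoid (GL-group 8)) G 255
G-cardinality = record
  { to        = λ i → pow (toℕ i) , pow∈G (toℕ i)
  ; cong      = λ { refl → refl }
  ; bijective = (λ {i} {j} → injective i j) , surjective
  }
  where
  -- The exponent can be recovered from the image of 1, hence different exponents below 255 give
  -- different matrices.
  log-pow : ∀ (i : Fin 255) → log (mat (pow (toℕ i)) *ᵥ exp 0) ≡ toℕ i
  log-pow i = begin
    log (mat (pow (toℕ i)) *ᵥ exp 0)   ≡⟨ cong log (pow-exp (toℕ i) 0) ⟩
    log (exp (toℕ i + 0))              ≡⟨ cong (log ∘ exp) (ℕ.+-identityʳ (toℕ i)) ⟩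
    log (exp (toℕ i))                  ≡⟨ log-exp (toℕ i) ⟩
    toℕ i % 255                        ≡⟨ m<n⇒m%n≡m (Fin.toℕ<n i) ⟩
    toℕ i                              ∎
    where open ≡-Reasoning
  injective : ∀ (i j : Fin 255) → mat (pow (toℕ i)) ≡ mat (pow (toℕ j)) → i ≡ j
  injective i j eq = Fin.toℕ-injective
    (trans (sym (log-pow i)) (trans (cong (λ M → log (M *ᵥ exp 0)) eq) (log-pow j)))
  surjective : ∀ (g : ∃ (_∈ G)) → ∃[ i ] ∀ {z} → z ≡ i → mat (pow (toℕ z)) ≡ mat (proj₁ g)
  surjective (g , g∈G) = let k , g≈ = G⇒pow g∈G in k mod 255 , λ { refl →
    trans (cong (mat ∘ pow) (Fin.toℕ-fromℕ< (m%n<n k 255))) (trans (pow-% k) (sym g≈)) }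

-- Inclusions certified by logarithms

Logs : Vec (V 8) k → Table ℕ k
Logs vs = tabulate (λ c → log (lincomb c vs))

-- For t = Logs vs this says that αʲ maps ⟨αᵉ | e ∈ es⟩ into the span of vs.
Hits : ℕ → Vec ℕ m → Table ℕ n → Set
Hits j es t = All (λ e → ∃[ c ] t ! c ≡ (j + e) % 255) es

hits? : ∀ j (es : Vec ℕ m) (t : Table ℕ n) → Dec (Hits j es t)
hits? j es t = All.all? (λ e → hit? ((j + e) % 255)) es
  where
  hit? : ∀ l → Dec (∃[ c ] t ! c ≡ l)
  hit? l = anyV? (λ c → t ! c ℕ.≟ l)

hits⇒exp∈ : ∀ j {es : Vec ℕ m} (vs : Vec (V 8) n) → Hits j es (Logs vs) →
            All (λ e → exp (j + e) ∈ Span vs) es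
hits⇒exp∈ j vs = All.map λ {e} → λ { (c , eq) →
  c , log≡⇒exp (lincomb c vs) (j + e)
        (trans (sym (tabulate-! (λ c → log (lincomb c vs)) c)) eq) }

-- By linearity it is enough to place the translates αʲ⁺ᵉ of the spanning vectors in `W`; this is
-- what a `Hits` certificate provides through `hits⇒exp∈`.
exp∈⇒image⊆ : ∀ j {W : Pred (V 8) 0ℓ} → IsSubspace W → {es : Vec ℕ m} →
              All (λ e → exp (j + e) ∈ W) es → image (pow j) (Span (map exp es)) ⊆ W
exp∈⇒image⊆ j {W} sub {es} es∈W {y} (x , (c , eq) , y≡) = subst W
  (sym (trans y≡ (trans (cong (mat (pow j) *ᵥ_) (sym eq)) (*ᵥ-lincomb (mat (pow j)) c (map exp es)))))
  (lincomb-closed sub (All.map⁺ (All.map⁺ (All.map (λ {e} → subst W (sym (pow-exp j e))) es∈W))) c)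

-- The tables

infixl 6 _⊖_
-- Division in the field, seen on logarithms. Truncated subtraction is harmless, as table entries
-- are at most 255.
_⊖_ : ℕ → ℕ → ℕ
d ⊖ e = (d + (255 ∸ e)) % 255

-- For t = Logs vs this says that (a , b) is lexicographically least among the
-- pairs with ⟨1, αᵃ, αᵇ⟩ a translate of the span of vs; c, c₁, c₂ are the
-- coordinates of the vectors carried to 1, αᵃ, αᵇ.
LexMin : ℕ × ℕ → Table ℕ 3 → Set
LexMin (a , b) t = ∀ c c₁ → Independent (c ∷ c₁ ∷ []) →
  a < t ! c₁ ⊖ t ! c ⊎
  (a ≡ t ! c₁ ⊖ t ! c × ∀ c₂ → Independent (c ∷ c₁ ∷ c₂ ∷ []) → b ≤ t ! c₂ ⊖ t ! c)

lexMin? : ∀ p t → Dec (LexMin p t)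
lexMin? (a , b) t = allV? λ c → allV? λ c₁ → independent? (c ∷ c₁ ∷ []) →-dec
  ((a ℕ.<? t ! c₁ ⊖ t ! c) ⊎-dec
   ((a ℕ.≟ t ! c₁ ⊖ t ! c) ×-dec
    allV? λ c₂ → independent? (c ∷ c₁ ∷ c₂ ∷ []) →-dec (b ℕ.≤? t ! c₂ ⊖ t ! c)))

triple : ℕ × ℕ → Vec ℕ 3
triple (a , b) = 0 ∷ a ∷ b ∷ []

pair : ℕ × ℕ → Vec ℕ 2
pair (p , q) = p ∷ q ∷ []

-- Echelon form: the first two rows span a plane with pivots in the first two coordinates, so a
-- 3-subspace above it is determined by its vectors that vanish there.
reduced : V n → V n → V n → Vec (V (2 + n)) 3
reduced a b y = (I ∷ O ∷ a) ∷ (O ∷ I ∷ b) ∷ (O ∷ O ∷ y) ∷ []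

abstract
  -- A pair (p , q) is chosen so that αᵖ = (1,0,a) and α^q = (0,1,b), which `planeBasis-exp`
  -- confirms. The last pair spans the subfield with four elements, whose orbit has 85 planes; the
  -- other 42 orbits have 255 each, and 42 · 255 + 85 = 10795 is the number of all planes.
  planeExps : Fin 43 → ℕ × ℕ
  planeExps = lookup table
    where
    table : Vec (ℕ × ℕ) 43
    table =
      (0 , 1) ∷ (21 , 19) ∷ (12 , 9) ∷ (18 , 22) ∷ (21 , 26) ∷ (21 , 15) ∷ (8 , 1) ∷
      (23 , 15) ∷ (0 , 9) ∷ (12 , 1) ∷ (21 , 9) ∷ (32 , 19) ∷ (8 , 22) ∷ (0 , 15) ∷
      (18 , 34) ∷ (18 , 1) ∷ (0 , 19) ∷ (21 , 1) ∷ (32 , 9) ∷ (0 , 26) ∷ (36 , 9) ∷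
      (12 , 40) ∷ (8 , 37) ∷ (39 , 9) ∷ (0 , 34) ∷ (0 , 37) ∷ (39 , 1) ∷ (12 , 51) ∷
      (0 , 40) ∷ (42 , 1) ∷ (8 , 51) ∷ (21 , 67) ∷ (56 , 9) ∷ (50 , 1) ∷ (18 , 70) ∷
      (12 , 65) ∷ (32 , 88) ∷ (86 , 26) ∷ (12 , 73) ∷ (0 , 65) ∷ (80 , 1) ∷ (8 , 88) ∷
      (0 , 85) ∷ []

  -- A solution of the Kramer–Mesner system, 127 representatives per class.
  repTable : Vec (ℕ × ℕ) (3 * 127)
  repTable =
    (1 , 3) ∷ (1 , 6) ∷ (1 , 15) ∷ (1 , 16) ∷ (1 , 20) ∷ (1 , 23) ∷ (1 , 29) ∷ (1 , 31) ∷
    (1 , 37) ∷ (1 , 38) ∷ (1 , 39) ∷ (1 , 53) ∷ (1 , 54) ∷ (1 , 59) ∷ (1 , 65) ∷ (1 , 81) ∷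
    (1 , 86) ∷ (1 , 89) ∷ (1 , 116) ∷ (1 , 119) ∷ (1 , 149) ∷ (2 , 6) ∷ (2 , 14) ∷ (2 , 15) ∷
    (2 , 18) ∷ (2 , 29) ∷ (2 , 31) ∷ (2 , 38) ∷ (2 , 40) ∷ (2 , 43) ∷ (2 , 55) ∷ (2 , 57) ∷
    (2 , 58) ∷ (2 , 76) ∷ (2 , 77) ∷ (2 , 78) ∷ (2 , 87) ∷ (2 , 88) ∷ (3 , 10) ∷ (3 , 19) ∷
    (3 , 23) ∷ (3 , 30) ∷ (3 , 37) ∷ (3 , 46) ∷ (3 , 47) ∷ (3 , 56) ∷ (3 , 57) ∷ (3 , 59) ∷
    (3 , 60) ∷ (3 , 61) ∷ (3 , 62) ∷ (3 , 64) ∷ (3 , 91) ∷ (3 , 111) ∷ (3 , 119) ∷ (4 , 11) ∷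
    (4 , 12) ∷ (4 , 20) ∷ (4 , 26) ∷ (4 , 38) ∷ (4 , 43) ∷ (4 , 53) ∷ (4 , 58) ∷ (4 , 61) ∷
    (4 , 62) ∷ (4 , 69) ∷ (4 , 81) ∷ (4 , 95) ∷ (4 , 119) ∷ (4 , 146) ∷ (5 , 17) ∷ (5 , 18) ∷
    (5 , 43) ∷ (5 , 44) ∷ (5 , 54) ∷ (5 , 57) ∷ (5 , 80) ∷ (5 , 129) ∷ (5 , 151) ∷ (6 , 13) ∷
    (6 , 19) ∷ (6 , 29) ∷ (6 , 34) ∷ (6 , 46) ∷ (6 , 47) ∷ (6 , 55) ∷ (6 , 60) ∷ (6 , 78) ∷
    (6 , 93) ∷ (7 , 17) ∷ (7 , 19) ∷ (7 , 22) ∷ (7 , 27) ∷ (7 , 30) ∷ (7 , 36) ∷ (7 , 69) ∷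
    (8 , 17) ∷ (8 , 38) ∷ (8 , 59) ∷ (8 , 60) ∷ (8 , 81) ∷ (8 , 110) ∷ (8 , 118) ∷ (9 , 23) ∷
    (9 , 31) ∷ (9 , 39) ∷ (9 , 46) ∷ (9 , 49) ∷ (9 , 78) ∷ (9 , 87) ∷ (9 , 89) ∷ (10 , 36) ∷
    (10 , 51) ∷ (10 , 67) ∷ (10 , 79) ∷ (10 , 108) ∷ (10 , 129) ∷ (13 , 30) ∷ (13 , 60) ∷ (14 , 28) ∷
    (14 , 54) ∷ (15 , 61) ∷ (15 , 76) ∷ (15 , 89) ∷ (16 , 57) ∷ (16 , 65) ∷ (19 , 72) ∷ (1 , 2) ∷
    (1 , 4) ∷ (1 , 8) ∷ (1 , 9) ∷ (1 , 11) ∷ (1 , 12) ∷ (1 , 13) ∷ (1 , 18) ∷ (1 , 19) ∷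
    (1 , 27) ∷ (1 , 30) ∷ (1 , 32) ∷ (1 , 62) ∷ (1 , 78) ∷ (1 , 79) ∷ (1 , 80) ∷ (1 , 97) ∷
    (1 , 118) ∷ (1 , 143) ∷ (2 , 12) ∷ (2 , 13) ∷ (2 , 16) ∷ (2 , 19) ∷ (2 , 20) ∷ (2 , 22) ∷
    (2 , 30) ∷ (2 , 56) ∷ (2 , 59) ∷ (2 , 62) ∷ (2 , 69) ∷ (2 , 80) ∷ (2 , 81) ∷ (2 , 89) ∷
    (2 , 96) ∷ (2 , 119) ∷ (2 , 125) ∷ (2 , 135) ∷ (2 , 148) ∷ (3 , 8) ∷ (3 , 12) ∷ (3 , 15) ∷
    (3 , 17) ∷ (3 , 22) ∷ (3 , 39) ∷ (3 , 41) ∷ (3 , 43) ∷ (3 , 44) ∷ (3 , 65) ∷ (3 , 72) ∷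
    (3 , 76) ∷ (3 , 78) ∷ (3 , 117) ∷ (3 , 155) ∷ (4 , 8) ∷ (4 , 9) ∷ (4 , 15) ∷ (4 , 30) ∷
    (4 , 31) ∷ (4 , 41) ∷ (4 , 59) ∷ (4 , 73) ∷ (4 , 79) ∷ (4 , 80) ∷ (4 , 85) ∷ (4 , 152) ∷
    (5 , 10) ∷ (5 , 15) ∷ (5 , 56) ∷ (5 , 59) ∷ (5 , 64) ∷ (5 , 72) ∷ (5 , 86) ∷ (5 , 119) ∷
    (5 , 123) ∷ (6 , 12) ∷ (6 , 40) ∷ (6 , 59) ∷ (6 , 71) ∷ (6 , 77) ∷ (6 , 85) ∷ (6 , 134) ∷
    (7 , 14) ∷ (7 , 23) ∷ (7 , 43) ∷ (7 , 56) ∷ (7 , 60) ∷ (7 , 72) ∷ (7 , 79) ∷ (7 , 85) ∷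
    (7 , 102) ∷ (7 , 142) ∷ (8 , 16) ∷ (8 , 37) ∷ (8 , 39) ∷ (8 , 47) ∷ (8 , 65) ∷ (8 , 97) ∷
    (8 , 116) ∷ (9 , 22) ∷ (9 , 26) ∷ (9 , 28) ∷ (9 , 29) ∷ (9 , 52) ∷ (9 , 58) ∷ (9 , 74) ∷
    (9 , 81) ∷ (9 , 151) ∷ (9 , 163) ∷ (10 , 37) ∷ (10 , 88) ∷ (10 , 97) ∷ (12 , 26) ∷ (12 , 38) ∷
    (12 , 58) ∷ (12 , 61) ∷ (12 , 114) ∷ (13 , 28) ∷ (14 , 29) ∷ (15 , 56) ∷ (15 , 62) ∷ (15 , 71) ∷
    (15 , 102) ∷ (16 , 36) ∷ (16 , 74) ∷ (16 , 77) ∷ (16 , 165) ∷ (20 , 72) ∷ (1 , 5) ∷ (1 , 7) ∷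
    (1 , 10) ∷ (1 , 17) ∷ (1 , 28) ∷ (1 , 40) ∷ (1 , 41) ∷ (1 , 44) ∷ (1 , 48) ∷ (1 , 52) ∷
    (1 , 55) ∷ (1 , 56) ∷ (1 , 57) ∷ (1 , 61) ∷ (1 , 72) ∷ (1 , 74) ∷ (1 , 77) ∷ (1 , 87) ∷
    (1 , 94) ∷ (1 , 96) ∷ (1 , 135) ∷ (2 , 4) ∷ (2 , 5) ∷ (2 , 7) ∷ (2 , 8) ∷ (2 , 9) ∷
    (2 , 10) ∷ (2 , 11) ∷ (2 , 17) ∷ (2 , 34) ∷ (2 , 41) ∷ (2 , 46) ∷ (2 , 54) ∷ (2 , 60) ∷
    (2 , 67) ∷ (2 , 73) ∷ (2 , 93) ∷ (2 , 97) ∷ (2 , 110) ∷ (3 , 6) ∷ (3 , 7) ∷ (3 , 9) ∷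
    (3 , 11) ∷ (3 , 20) ∷ (3 , 29) ∷ (3 , 40) ∷ (3 , 49) ∷ (3 , 55) ∷ (3 , 67) ∷ (3 , 79) ∷
    (3 , 96) ∷ (3 , 114) ∷ (4 , 10) ∷ (4 , 16) ∷ (4 , 18) ∷ (4 , 19) ∷ (4 , 34) ∷ (4 , 40) ∷
    (4 , 44) ∷ (4 , 51) ∷ (4 , 55) ∷ (4 , 57) ∷ (4 , 115) ∷ (5 , 11) ∷ (5 , 14) ∷ (5 , 19) ∷
    (5 , 28) ∷ (5 , 31) ∷ (5 , 58) ∷ (5 , 67) ∷ (5 , 69) ∷ (5 , 79) ∷ (5 , 91) ∷ (5 , 93) ∷
    (6 , 14) ∷ (6 , 15) ∷ (6 , 16) ∷ (6 , 22) ∷ (6 , 37) ∷ (6 , 57) ∷ (6 , 65) ∷ (6 , 79) ∷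
    (7 , 29) ∷ (7 , 37) ∷ (7 , 38) ∷ (7 , 44) ∷ (7 , 47) ∷ (7 , 59) ∷ (7 , 67) ∷ (7 , 125) ∷
    (8 , 18) ∷ (8 , 20) ∷ (8 , 30) ∷ (8 , 73) ∷ (8 , 102) ∷ (8 , 124) ∷ (9 , 19) ∷ (9 , 37) ∷
    (9 , 40) ∷ (9 , 62) ∷ (10 , 38) ∷ (10 , 47) ∷ (10 , 49) ∷ (10 , 62) ∷ (10 , 75) ∷ (10 , 86) ∷
    (12 , 28) ∷ (12 , 29) ∷ (12 , 71) ∷ (12 , 81) ∷ (12 , 93) ∷ (13 , 43) ∷ (13 , 54) ∷ (14 , 43) ∷
    (14 , 60) ∷ (14 , 94) ∷ (15 , 49) ∷ (15 , 52) ∷ (15 , 53) ∷ (15 , 72) ∷ (16 , 39) ∷ (16 , 87) ∷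
    (17 , 34) ∷ (20 , 76) ∷ (20 , 79) ∷ (20 , 98) ∷ (28 , 56) ∷ []

  repExps : Fin 3 → Fin 127 → ℕ × ℕ
  repExps i m = lookup repTable (combine i m)

  -- A code 255 r + k stands for: αᵏ maps plane r onto ⟨1, (0,x)⟩.  The code
  -- itself serves as exponent, because α²⁵⁵ = 1.
  planeCode : V 7 → ℕ
  planeCode x = table ! x
    where
    table : Table ℕ 7
    table =
      (((((((0 , 1784) , (1515 , 3083)) , ((1254 , 1825) , (6111 , 8855))) , (((1002 , 5570) , (8359 , 9021)) , ((5857 , 3028) , (9115 , 10454))))
      , ((((756 , 5676) , (5828 , 4836)) , ((9168 , 2175) , (8472 , 2549))) , (((5598 , 4079) , (3293 , 998)) , ((8305 , 9664) , (7854 , 7608)))))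
      , (((((491 , 2669) , (6341 , 9532)) , ((6081 , 7022) , (9604 , 2942))) , (((8907 , 6884) , (1672 , 7649)) , ((7128 , 4589) , (2304 , 230))))
      , ((((5346 , 8669) , (3807 , 2796)) , ((3555 , 753) , (1249 , 1116))) , (((2025 , 533) , (9403 , 4011)) , ((5319 , 6700) , (2784 , 10702))))))
      , ((((((0 , 2017) , (7492 , 7089)) , ((8406 , 8093) , (4243 , 10375))) , (((3307 , 6239) , (8620 , 4640)) , ((9872 , 7311) , (902 , 4547))))
      , ((((4062 , 3537) , (6375 , 4316)) , ((6593 , 5242) , (7140 , 4569))) , (((1777 , 6846) , (4080 , 7776)) , ((2040 , 4902) , (5074 , 2538)))))
      , (((((4845 , 3041) , (489 , 8002)) , ((3315 , 441) , (3662 , 10280))) , (((3791 , 9272) , (6045 , 10710)) , ((1509 , 10038) , (7897 , 4813))))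
      , ((((9347 , 254) , (6120 , 2286)) , ((9747 , 10135) , (9933 , 7355))) , (((6451 , 8139) , (1324 , 5405)) , ((8766 , 9945) , (10534 , 10622)))))))

  -- A code 255 (127 i + m) + k stands for: αᵏ maps representative m of class i
  -- onto the span of plane r and (0,0,y).
  spaceCode : Fin 43 → V 6 → ℕ
  spaceCode r y = lookup table r ! y
    where
    table : Vec (Table ℕ 6) 43
    table =
      ((((((0 , 65025) , (255 , 1785)) , ((64770 , 67320) , (34935 , 4335)))
      , (((32640 , 4845) , (3060 , 3315)) , ((1530 , 4080) , (69360 , 35955))))
      , ((((0 , 68595) , (2040 , 1275)) , ((2805 , 69870) , (66045 , 33405)))
      , (((65790 , 65535) , (34425 , 69615)) , ((33150 , 67830) , (35700 , 4590)))))
      , (((((32385 , 33915) , (66810 , 36720)) , ((510 , 5100) , (68340 , 3825)))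
      , (((67065 , 2295) , (36975 , 66300)) , ((2550 , 1020) , (65280 , 32615))))
      , ((((34680 , 32639) , (765 , 33660)) , ((34170 , 36465) , (68085 , 66555)))
      , (((32895 , 35190) , (67575 , 35445)) , ((68850 , 3570) , (69105 , 36210)))))) ∷
      ((((((0 , 8944) , (38269 , 37249)) , ((39034 , 70399) , (71674 , 6904)))
      , (((6139 , 72949) , (71929 , 40564)) , ((71419 , 66831) , (6649 , 73204))))
      , ((((5629 , 7159) , (70349 , 39544)) , ((72184 , 41329) , (9454 , 37504)))
      , (((71164 , 70142) , (18 , 1526)) , ((74479 , 8434) , (39289 , 74224)))))
      , (((((5169 , 7414) , (7924 , 73459)) , ((41839 , 39799) , (40309 , 72694)))
      , (((5884 , 38014) , (41074 , 38524)) , ((9199 , 32404) , (73714 , 73969))))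
      , ((((70909 , 38779) , (41584 , 72439)) , ((5374 , 8689) , (34929 , 3128)))
      , (((6394 , 37759) , (70654 , 40054)) , ((8179 , 70144) , (40819 , 7669)))))) ∷
      ((((((0 , 70387) , (74721 , 43104)) , ((77529 , 10974) , (9699 , 75234)))
      , (((44634 , 11229) , (10209 , 32648)) , ((75744 , 33647) , (36477 , 13014))))
      , ((((77784 , 45144) , (13779 , 43614)) , ((44124 , 76764) , (10719 , 66821)))
      , (((9954 , 42084) , (39452 , 12249)) , ((741 , 42339) , (42594 , 10464)))))
      , (((((35422 , 11484) , (44379 , 77274)) , ((77019 , 76509) , (12504 , 41577)))
      , (((43869 , 75999) , (11994 , 74756)) , ((6334 , 75489) , (9 , 72395))))
      , ((((72142 , 76254) , (74979 , 13524)) , ((66029 , 11739) , (6082 , 44889)))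
      , (((74724 , 68037) , (45399 , 13269)) , ((42849 , 12759) , (43359 , 45654)))))) ∷
      ((((((0 , 65532) , (80598 , 3942)) , ((80088 , 78813) , (14298 , 46428)))
      , (((48723 , 72902) , (13059 , 16338)) , ((14043 , 32658) , (15063 , 16083))))
      , ((((78558 , 48468) , (40822 , 80343)) , ((42890 , 15318) , (47958 , 79833)))
      , (((78048 , 64787) , (36486 , 17103)) , ((47193 , 16593) , (42480 , 72536)))))
      , (((((14808 , 48213) , (79323 , 77542)) , ((73153 , 78303) , (47703 , 69637)))
      , (((79068 , 14553) , (69478 , 45914)) , ((79578 , 70143) , (17358 , 15828))))
      , ((((46173 , 46938) , (5371 , 74985)) , ((17613 , 46683) , (16848 , 45918)))
      , (((46073 , 45763) , (2388 , 1778)) , ((47448 , 15573) , (44485 , 7513)))))) ∷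
      ((((((0 , 6861) , (18126 , 48981)) , ((19656 , 41212) , (80606 , 66714)))
      , (((48354 , 79991) , (49236 , 50001)) , ((44651 , 50256) , (69640 , 82131))))
      , ((((19911 , 49746) , (7876 , 9289)) , ((43403 , 51021) , (50511 , 80856)))
      , (((8186 , 46172) , (42093 , 35186)) , ((83406 , 18636) , (19146 , 82386)))))
      , (((((1021 , 50766) , (17266 , 36878)) , ((19401 , 71814) , (82896 , 75381)))
      , (((81876 , 17871) , (49098 , 17654)) , ((12941 , 275) , (15455 , 83151))))
      , ((((68111 , 81621) , (48976 , 45549)) , ((18381 , 82641) , (81366 , 64791)))
      , (((11278 , 81111) , (70654 , 2939)) , ((49491 , 70401) , (18891 , 41589)))))) ∷
      ((((((0 , 67781) , (65039 , 84165)) , ((19656 , 51525) , (83910 , 77213)))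
      , (((84930 , 22200) , (46431 , 22455)) , ((83655 , 46841) , (45692 , 51334))))
      , ((((52290 , 85185) , (38731 , 20670)) , ((13823 , 38964) , (20415 , 78041)))
      , (((20160 , 5370) , (74730 , 34676)) , ((82821 , 75237) , (21690 , 21435)))))
      , (((((85440 , 13211) , (4516 , 52035)) , ((38201 , 52800) , (52545 , 71301)))
      , (((84675 , 50186) , (17988 , 70903)) , ((48556 , 68105) , (80845 , 3775))))
      , ((((51270 , 20925) , (270 , 2571)) , ((79256 , 39235) , (84420 , 18938)))
      , (((51264 , 2030) , (21945 , 77796)) , ((21180 , 41331) , (40819 , 51780)))))) ∷
      ((((((0 , 2557) , (8166 , 23716)) , ((77525 , 15664) , (85681 , 54571)))
      , (((74971 , 53296) , (13660 , 79823)) , ((22696 , 14277) , (54061 , 7608))))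
      , ((((70636 , 55081) , (23971 , 54316)) , ((86191 , 53184) , (77050 , 35421)))
      , (((23461 , 80593) , (9943 , 49073)) , ((65798 , 53806) , (13880 , 11588)))))
      , (((((65026 , 87211) , (86701 , 85602)) , ((53041 , 86956) , (87466 , 15966)))
      , (((34408 , 85936) , (55336 , 23206)) , ((53289 , 22951) , (8423 , 49445))))
      , ((((20408 , 71399) , (8111 , 37851)) , ((49595 , 54826) , (20395 , 53551)))
      , (((32895 , 69982) , (24226 , 86446)) , ((37088 , 70953) , (73043 , 36298)))))) ∷
      ((((((0 , 55597) , (25005 , 55605)) , ((755 , 44170) , (65048 , 25260)))
      , (((25515 , 18060) , (56115 , 23626)) , ((67789 , 10667) , (80285 , 20989))))
      , ((((88245 , 36400) , (56880 , 87735)) , ((24750 , 65788) , (71413 , 14291)))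
      , (((83153 , 70905) , (8580 , 88500)) , ((47090 , 19257) , (55660 , 56370)))))
      , (((((75492 , 82760) , (78973 , 76970)) , ((88755 , 26025) , (89010 , 42090)))
      , (((55860 , 47641) , (24495 , 8118)) , ((56625 , 44645) , (7865 , 38478))))
      , ((((17363 , 21890) , (32910 , 65812)) , ((67535 , 8380) , (10447 , 37508)))
      , (((83649 , 87990) , (57135 , 25770)) , ((81677 , 41331) , (45915 , 33164)))))) ∷
      ((((((0 , 8422) , (77781 , 26520)) , ((80585 , 56665) , (89250 , 28050)))
      , (((46155 , 59415) , (89760 , 57375)) , ((58140 , 18342) , (89505 , 21493))))
      , ((((75225 , 58905) , (75122 , 26265)) , ((18624 , 884) , (58650 , 73704)))
      , (((57885 , 24999) , (59670 , 3920)) , ((33150 , 24727) , (27540 , 72634)))))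
      , (((((71145 , 88095) , (27795 , 76875)) , ((55448 , 27030) , (41380 , 90015)))
      , (((58395 , 52204) , (53693 , 77306)) , ((26775 , 65534) , (33669 , 995))))
      , ((((84144 , 27285) , (69990 , 13524)) , ((1004 , 42582) , (81340 , 41685)))
      , (((65033 , 39475) , (19761 , 59160)) , ((57630 , 16329) , (71908 , 72793)))))) ∷
      ((((((0 , 19642) , (80836 , 55912)) , ((14026 , 22240) , (46662 , 84927)))
      , (((75481 , 56921) , (88786 , 79823)) , ((90516 , 32882) , (86855 , 60426))))
      , ((((71656 , 35411) , (4602 , 73381)) , ((91281 , 55224) , (91026 , 33416)))
      , (((60171 , 15446) , (49456 , 49206)) , ((741 , 26532) , (28806 , 37474)))))
      , (((((33406 , 29571) , (89487 , 87958)) , ((33650 , 29061) , (58521 , 16476)))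
      , (((22934 , 90771) , (6592 , 71646)) , ((9936 , 25512) , (73705 , 29826))))
      , ((((28551 , 37739) , (65526 , 33660)) , ((84390 , 91536) , (78276 , 45179)))
      , (((52606 , 7346) , (29316 , 9447)) , ((91791 , 20720) , (48107 , 60681)))))) ∷
      ((((((0 , 5617) , (42591 , 9711)) , ((78290 , 29206) , (71674 , 39914)))
      , (((17854 , 92574) , (78576 , 69126)) , ((88251 , 61719) , (91809 , 21748))))
      , ((((81088 , 92319) , (7111 , 14289)) , ((11783 , 24616) , (33923 , 37239)))
      , (((11608 , 17357) , (13533 , 34166)) , ((87976 , 42339) , (76636 , 61209)))))
      , (((((22952 , 15181) , (92829 , 74291)) , ((25321 , 34051) , (61464 , 57531)))
      , (((52915 , 92064) , (70771 , 43136)) , ((88676 , 4610) , (33669 , 4956))))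
      , ((((52296 , 39739) , (80601 , 27157)) , ((2279 , 79736) , (60954 , 84745)))
      , (((51264 , 60699) , (49086 , 67200)) , ((49491 , 8946) , (29440 , 77688)))))) ∷
      ((((((0 , 33667) , (20413 , 69136)) , ((59524 , 26120) , (9465 , 4112)))
      , (((50522 , 93349) , (77061 , 60033)) , ((75509 , 32658) , (66417 , 30109))))
      , ((((92046 , 20026) , (7874 , 11115)) , ((91577 , 85712) , (60532 , 37504)))
      , (((16348 , 5882) , (51118 , 82988)) , ((20582 , 80102) , (87627 , 74066)))))
      , (((((41888 , 93094) , (84501 , 20164)) , ((58817 , 81239) , (16944 , 61984)))
      , (((38282 , 85457) , (3943 , 18119)) , ((92161 , 33934) , (57385 , 54433))))
      , ((((83157 , 29854) , (72402 , 90133)) , ((45508 , 56528) , (2544 , 1623)))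
      , (((85282 , 12272) , (20426 , 16252)) , ((57238 , 61870) , (45760 , 40663)))))) ∷
      ((((((0 , 517) , (37746 , 59692)) , ((42845 , 62228) , (88762 , 93593)))
      , (((78544 , 70607) , (13314 , 32648)) , ((14043 , 33657) , (81098 , 92925))))
      , ((((81348 , 40472) , (84886 , 26932)) , ((30384 , 83524) , (4101 , 35421)))
      , (((38208 , 18632) , (26752 , 60941)) , ((30353 , 78417) , (39037 , 56324)))))
      , (((((2017 , 93848) , (94103 , 82235)) , ((86415 , 60967) , (26519 , 83648)))
      , (((89983 , 16738) , (28193 , 34447)) , ((30608 , 8945) , (5618 , 6095))))
      , ((((6862 , 87375) , (67782 , 53048)) , ((80247 , 52871) , (51094 , 48727)))
      , (((10432 , 59527) , (93508 , 30594)) , ((47152 , 57183) , (82087 , 2788)))))) ∷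
      ((((((0 , 8110) , (83895 , 5641)) , ((49215 , 38263) , (72163 , 31365)))
      , (((46410 , 24383) , (60213 , 92471)) , ((48734 , 62207) , (30024 , 48620))))
      , ((((42585 , 22537) , (30855 , 87735)) , ((94860 , 1019) , (68628 , 65525)))
      , (((50518 , 6135) , (62461 , 79046)) , ((31110 , 51132) , (83704 , 62730)))))
      , (((((5865 , 92693) , (63240 , 54746)) , ((510 , 47618) , (95115 , 30246)))
      , (((94605 , 19923) , (80735 , 89028)) , ((34439 , 18120) , (80845 , 66275))))
      , ((((52302 , 94350) , (34185 , 9702)) , ((72148 , 72130) , (17628 , 50862)))
      , (((65033 , 32) , (62475 , 28539)) , ((23453 , 62985) , (78555 , 27963)))))) ∷
      ((((((0 , 60177) , (91806 , 12271)) , ((85268 , 29614) , (80610 , 84417)))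
      , (((16734 , 21392) , (63513 , 25918)) , ((15463 , 39047) , (14549 , 30665))))
      , ((((5644 , 68503) , (55608 , 84058)) , ((44930 , 45040) , (9960 , 53306)))
      , (((19669 , 65552) , (72404 , 31893)) , ((63768 , 14198) , (66548 , 22087)))))
      , (((((44914 , 81735) , (34203 , 64278)) , ((38983 , 78303) , (45330 , 48973)))
      , (((783 , 14824) , (95643 , 49628)) , ((79494 , 37758) , (33159 , 95388))))
      , ((((70008 , 48768) , (6136 , 24824)) , ((94590 , 64023) , (31638 , 84168)))
      , (((94753 , 67099) , (12658 , 33822)) , ((26165 , 74623) , (40403 , 70796)))))) ∷
      ((((((0 , 78282) , (17851 , 41887)) , ((45746 , 84678) , (27166 , 84927)))
      , (((42841 , 59058) , (30078 , 90839)) , ((22696 , 30363) , (83194 , 58599))))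
      , ((((71911 , 96068) , (43674 , 14349)) , ((9995 , 49483) , (75988 , 79833)))
      , (((28578 , 67082) , (18 , 1251)) , ((24481 , 25369) , (59229 , 92299)))))
      , (((((65536 , 18495) , (28353 , 90505)) , ((6088 , 19449) , (64184 , 48351)))
      , (((96119 , 26325) , (86657 , 64329)) , ((33143 , 5168) , (25000 , 80498))))
      , ((((58158 , 38249) , (6136 , 31986)) , ((34170 , 57877) , (50166 , 35744)))
      , (((53874 , 95881) , (35514 , 87527)) , ((80084 , 40869) , (73646 , 85507)))))) ∷
      ((((((0 , 22950) , (20400 , 60709)) , ((81345 , 55900) , (89250 , 77864)))
      , (((78795 , 58112) , (43656 , 94827)) , ((56949 , 77029) , (74552 , 17004))))
      , ((((9945 , 87794) , (6854 , 47704)) , ((17495 , 27675) , (63332 , 25511)))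
      , (((21512 , 5167) , (34425 , 46147)) , ((58039 , 76337) , (59762 , 36811)))))
      , (((((37995 , 6975) , (29672 , 93963)) , ((19467 , 16153) , (32130 , 20301)))
      , (((50881 , 58131) , (53948 , 1274)) , ((94187 , 1294) , (73714 , 66785))))
      , ((((88504 , 54910) , (44896 , 11599)) , ((68613 , 43347) , (504 , 35027)))
      , (((71653 , 12272) , (85954 , 85438)) , ((94427 , 90341) , (78555 , 39985)))))) ∷
      ((((((0 , 2016) , (17634 , 4632)) , ((14536 , 61753) , (57396 , 32314)))
      , (((75736 , 63903) , (9723 , 31918)) , ((10453 , 83503) , (16008 , 88243))))
      , ((((38251 , 96391) , (38986 , 64516)) , ((75533 , 54204) , (77050 , 33426)))
      , (((23226 , 14807) , (18 , 65021)) , ((87976 , 26532) , (76065 , 43116)))))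
      , (((((1021 , 96646) , (49768 , 23114)) , ((38201 , 61349) , (85694 , 46311)))
      , (((26308 , 48371) , (17128 , 38546)) , ((23709 , 1295) , (65280 , 58387))))
      , ((((84426 , 38759) , (18121 , 64371)) , ((63735 , 93252) , (71138 , 35998)))
      , (((89071 , 88775) , (95756 , 27718)) , ((96136 , 38526) , (95083 , 94169)))))) ∷
      ((((((0 , 32392) , (68034 , 35986)) , ((45905 , 23913) , (9465 , 7343)))
      , (((81604 , 96575) , (10209 , 91567)) , ((43124 , 26274) , (12952 , 22003))))
      , ((((20658 , 51970) , (73340 , 25195)) , ((87744 , 53582) , (62706 , 37239)))
      , (((47713 , 47635) , (23890 , 26097)) , ((80271 , 16862) , (61533 , 42139)))))
      , (((((23717 , 92503) , (52116 , 49930)) , ((64320 , 49619) , (73909 , 87160)))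
      , (((96677 , 22472) , (59693 , 13556)) , ((85369 , 80844) , (1284 , 3520))))
      , ((((19917 , 87558) , (53304 , 12190)) , ((67049 , 66225) , (30581 , 89590)))
      , (((50180 , 39475) , (83001 , 78727)) , ((84686 , 95618) , (31652 , 47339)))))) ∷
      ((((((0 , 20407) , (71143 , 81371)) , ((49215 , 8620) , (79331 , 19323)))
      , (((14790 , 62895) , (89439 , 89666)) , ((45671 , 54401) , (80523 , 3488))))
      , ((((68028 , 34934) , (25781 , 39466)) , ((64058 , 56800) , (76558 , 28550)))
      , (((9206 , 58157) , (52849 , 46916)) , ((11928 , 50295) , (28128 , 31818)))))
      , (((((32385 , 21867) , (47273 , 95298)) , ((91316 , 29003) , (12435 , 85849)))
      , (((60959 , 92846) , (8308 , 62501)) , ((16259 , 84425) , (15455 , 230))))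
      , ((((35726 , 66242) , (29596 , 60690)) , ((89013 , 76242) , (82105 , 17107)))
      , (((8103 , 77807) , (85954 , 85113)) , ((57630 , 61016) , (61188 , 90759)))))) ∷
      ((((((0 , 6382) , (10461 , 49756)) , ((46925 , 94463) , (84945 , 91148)))
      , (((43386 , 52311) , (78576 , 51108)) , ((23234 , 95722) , (68886 , 51583))))
      , ((((83898 , 29428) , (96248 , 80438)) , ((59264 , 18768) , (13915 , 66821)))
      , (((88513 , 45909) , (37471 , 20003)) , ((65798 , 16862) , (76100 , 13373)))))
      , (((((69983 , 8733) , (91382 , 4423)) , ((55448 , 2152) , (47876 , 57666)))
      , (((64041 , 8706) , (55004 , 44666)) , ((20245 , 60179) , (34689 , 41166))))
      , ((((18114 , 84518) , (23469 , 93953)) , ((67304 , 27456) , (87362 , 59528)))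
      , (((84159 , 35735) , (50616 , 8884)) , ((28586 , 10268) , (74318 , 14444)))))) ∷
      ((((((0 , 49222) , (20916 , 21524)) , ((65802 , 24423) , (60210 , 38198)))
      , (((67524 , 64300) , (10209 , 42880)) , ((22707 , 3047) , (44572 , 95559))))
      , ((((89508 , 25850) , (91240 , 16525)) , ((91812 , 44697) , (91026 , 1541)))
      , (((70790 , 81612) , (89425 , 21370)) , ((46866 , 57897) , (6925 , 68889)))))
      , (((((90272 , 77564) , (96974 , 23388)) , ((38750 , 61977) , (78225 , 58797)))
      , (((15212 , 9218) , (96912 , 4885)) , ((90220 , 70902) , (38770 , 35650))))
      , ((((50530 , 59455) , (36480 , 39730)) , ((10692 , 62935) , (30357 , 31742)))
      , (((82565 , 12955) , (31089 , 54663)) , ((9142 , 59755) , (97139 , 69285)))))) ∷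
      ((((((0 , 34942) , (6636 , 22471)) , ((74752 , 62228) , (15995 , 86341)))
      , (((46414 , 24924) , (59094 , 69627)) , ((25529 , 71642) , (1538 , 63939))))
      , ((((41194 , 83059) , (23971 , 75159)) , ((37777 , 82147) , (85271 , 75998)))
      , (((57403 , 58148) , (75956 , 92051)) , ((4881 , 34868) , (75294 , 32227)))))
      , (((((45679 , 93653) , (20663 , 52203)) , ((43536 , 53332) , (50105 , 68784)))
      , (((30892 , 2077) , (27173 , 48742)) , ((14953 , 92063) , (6383 , 62960))))
      , ((((56957 , 34079) , (87728 , 97061)) , ((25171 , 93805) , (85688 , 31539)))
      , (((55845 , 8705) , (3298 , 8602)) , ((86522 , 25818) , (93834 , 48029)))))) ∷
      ((((((0 , 71917) , (42591 , 38494)) , ((79055 , 63534) , (26550 , 61658)))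
      , (((43386 , 24009) , (549 , 29844)) , ((4640 , 64737) , (6922 , 5428))))
      , ((((79244 , 46674) , (28803 , 18435)) , ((1793 , 53582) , (43712 , 38769)))
      , (((89259 , 88239) , (87137 , 93326)) , ((24736 , 50427) , (13080 , 10464)))))
      , (((((85937 , 91355) , (88579 , 90189)) , ((37050 , 91937) , (81160 , 83031)))
      , (((26140 , 2078) , (57696 , 70419)) , ((26775 , 55920) , (34944 , 79280))))
      , ((((5635 , 28344) , (23724 , 40249)) , ((67559 , 53363) , (89970 , 90600)))
      , (((68099 , 79340) , (19506 , 54900)) , ((41895 , 36539) , (55487 , 16739)))))) ∷
      ((((((0 , 69981) , (20910 , 35444)) , ((41191 , 25555) , (13071 , 56444)))
      , (((79050 , 96934) , (96424 , 4981)) , ((82139 , 40631) , (64609 , 92982))))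
      , ((((70633 , 30958) , (25781 , 91558)) , ((29706 , 33285) , (68628 , 7345)))
      , (((46854 , 95880) , (37979 , 15296)) , ((27829 , 47307) , (51759 , 96761)))))
      , (((((72165 , 17476) , (96101 , 30213)) , ((5389 , 61732) , (51901 , 18256)))
      , (((50881 , 7529) , (53176 , 55114)) , ((50269 , 88774) , (33669 , 3545))))
      , ((((13906 , 63274) , (765 , 88222)) , ((94590 , 10962) , (45523 , 81462)))
      , (((21875 , 66844) , (83516 , 95999)) , ((47840 , 96348) , (29185 , 44028)))))) ∷
      ((((((0 , 85935) , (84660 , 83671)) , ((11257 , 89050) , (24000 , 69028)))
      , (((78795 , 9102) , (86693 , 63131)) , ((8594 , 37727) , (89505 , 17164))))
      , ((((10710 , 24037) , (2040 , 80262)) , ((45059 , 77441) , (22286 , 90770)))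
      , (((59443 , 26324) , (30586 , 47426)) , ((64924 , 96603) , (31289 , 44326)))))
      , (((((72165 , 27276) , (96314 , 2549)) , ((37011 , 55372) , (12564 , 91714)))
      , (((52339 , 2842) , (24113 , 46192)) , ((39817 , 48370) , (59925 , 35675))))
      , ((((6628 , 92602) , (29596 , 69117)) , ((94845 , 76497) , (17628 , 9385)))
      , (((55845 , 41600) , (74589 , 33074)) , ((51547 , 51938) , (51498 , 60593)))))) ∷
      ((((((0 , 13809) , (17634 , 67551)) , ((15046 , 68524) , (75152 , 62122)))
      , (((74748 , 75920) , (63024 , 95794)) , ((16514 , 60946) , (43858 , 82483))))
      , ((((6886 , 51868) , (41857 , 55153)) , ((86191 , 53072) , (65574 , 90271)))
      , (((28578 , 14787) , (95101 , 18611)) , ((24736 , 92495) , (27421 , 37474)))))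
      , (((((2296 , 93416) , (56704 , 73878)) , ((4094 , 63644) , (9641 , 69775)))
      , (((83177 , 2843) , (96278 , 72714)) , ((2550 , 58132) , (52205 , 52824))))
      , ((((92847 , 7394) , (19924 , 63861)) , ((55830 , 43567) , (3755 , 19164)))
      , (((63170 , 7530) , (60748 , 73370)) , ((63208 , 77846) , (52454 , 31898)))))) ∷
      ((((((0 , 18622) , (2562 , 94199)) , ((37092 , 47481) , (60210 , 46428)))
      , (((56359 , 82416) , (77061 , 15308)) , ((75744 , 67817) , (27394 , 95598))))
      , ((((71656 , 31468) , (29443 , 65585)) , ((73491 , 28866) , (52712 , 66056)))
      , (((95382 , 45540) , (50281 , 81713)) , ((86129 , 26787) , (55490 , 74321)))))
      , (((((90782 , 61850) , (64362 , 54426)) , ((61318 , 87261) , (59346 , 75014)))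
      , (((1836 , 16271) , (5218 , 6387)) , ((17454 , 56112) , (72430 , 24088))))
      , ((((34451 , 39829) , (13053 , 27148)) , ((43362 , 30297) , (25363 , 14653)))
      , (((95531 , 31655) , (40762 , 63325)) , ((95349 , 36048) , (74830 , 7768)))))) ∷
      ((((((0 , 23205) , (51510 , 18655)) , ((11257 , 87775) , (28335 , 50829)))
      , (((79305 , 22922) , (89760 , 35783)) , ((56949 , 74034) , (86948 , 82444))))
      , ((((76245 , 25595) , (86485 , 87549)) , ((57259 , 59295) , (66045 , 71645)))
      , (((15200 , 64328) , (30841 , 79811)) , ((19071 , 1334) , (52863 , 10826)))))
      , (((((7140 , 79600) , (30924 , 54498)) , ((5389 , 27531) , (42402 , 66554)))
      , (((11814 , 72713) , (53438 , 66595)) , ((1824 , 38545) , (55921 , 3800))))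
      , ((((84509 , 77346) , (34185 , 39730)) , ((38503 , 44112) , (82105 , 20007)))
      , (((44155 , 42107) , (21414 , 58989)) , ((55412 , 4164) , (78524 , 79640)))))) ∷
      ((((((0 , 13809) , (35166 , 4632)) , ((47176 , 92184) , (34072 , 56250)))
      , (((43606 , 75258) , (29473 , 41928)) , ((91801 , 57162) , (11375 , 44368))))
      , ((((72421 , 21132) , (18397 , 93573)) , ((14067 , 53184) , (73480 , 88796)))
      , (((47172 , 67082) , (62716 , 36853)) , ((47627 , 62772) , (28806 , 57511)))))
      , (((((66301 , 62600) , (21972 , 413)) , ((87368 , 58799) , (10868 , 70281)))
      , (((90822 , 46193) , (31253 , 66596)) , ((71392 , 1020) , (77307 , 95273))))
      , ((((62502 , 7649) , (89029 , 30758)) , ((31860 , 10645) , (21670 , 40077)))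
      , (((96803 , 55115) , (91270 , 14848)) , ((76319 , 22505) , (27698 , 84302)))))) ∷
      ((((((0 , 66562) , (6636 , 96676)) , ((10970 , 15861) , (75520 , 93593)))
      , (((69464 , 18368) , (45186 , 15308)) , ((65288 , 22236) , (47814 , 6964))))
      , ((((70636 , 19171) , (60564 , 95421)) , ((8976 , 27837) , (93083 , 43868)))
      , (((36005 , 69998) , (23079 , 18096)) , ((24419 , 12114) , (84987 , 74163)))))
      , (((((51257 , 58649) , (80531 , 62302)) , ((69744 , 27591) , (57816 , 54869)))
      , (((35751 , 26139) , (59813 , 60221)) , ((47477 , 52914) , (7403 , 31340))))
      , ((((68621 , 40084) , (44163 , 72292)) , ((53558 , 11048) , (11091 , 86312)))
      , (((65773 , 64040) , (39654 , 51555)) , ((28179 , 88293) , (83755 , 82533)))))) ∷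
      ((((((0 , 93847) , (30861 , 4632)) , ((25905 , 5002) , (27051 , 81529)))
      , (((83197 , 29218) , (51153 , 40143)) , ((55603 , 44015) , (59107 , 61522))))
      , ((((48608 , 26168) , (41026 , 63546)) , ((35211 , 93984) , (87616 , 45199)))
      , (((37108 , 70142) , (76518 , 3821)) , ((10986 , 56677) , (90582 , 61209)))))
      , (((((20303 , 94475) , (12084 , 36878)) , ((73598 , 13673) , (92760 , 71301)))
      , (((34491 , 58178) , (17771 , 17148)) , ((31523 , 64790) , (28815 , 93938))))
      , ((((21186 , 61986) , (48349 , 87270)) , ((23925 , 97120) , (12430 , 67387)))
      , (((46213 , 13327) , (84281 , 25066)) , ((52682 , 72696) , (74015 , 86767)))))) ∷
      ((((((0 , 3116) , (66818 , 35986)) , ((79820 , 67375) , (90534 , 69469)))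
      , (((45532 , 11229) , (39069 , 40653)) , ((49776 , 54170) , (57894 , 84733))))
      , ((((18926 , 15766) , (93386 , 92239)) , ((11783 , 27939) , (43712 , 5874)))
      , (((59771 , 56364) , (21980 , 30341)) , ((55646 , 96480) , (76100 , 22295)))))
      , (((((15665 , 89816) , (56712 , 43183)) , ((61808 , 74419) , (30656 , 40860)))
      , (((15862 , 62229) , (31220 , 42626)) , ((72986 , 89495) , (64779 , 33260))))
      , ((((62979 , 86494) , (86709 , 83303)) , ((68579 , 21339) , (60928 , 2125)))
      , (((21429 , 91325) , (19761 , 8780)) , ((28361 , 60269) , (81710 , 15719)))))) ∷
      ((((((0 , 51256) , (42328 , 19498)) , ((42873 , 80020) , (63932 , 82308)))
      , (((76501 , 93769) , (72568 , 58700)) , ((16514 , 57162) , (16008 , 68826))))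
      , ((((3110 , 3512) , (90151 , 73381)) , ((9995 , 15807) , (28855 , 90781)))
      , (((23461 , 48751) , (83690 , 19121)) , ((10653 , 87005) , (59493 , 61699)))))
      , (((((32385 , 58897) , (72978 , 50790)) , ((13307 , 58848) , (12690 , 14691)))
      , (((41870 , 92603) , (37691 , 77347)) , ((54054 , 54911) , (27286 , 68003))))
      , ((((66243 , 5149) , (94351 , 95736)) , ((32115 , 88420) , (21925 , 22229)))
      , (((8358 , 63275) , (61398 , 29247)) , ((51624 , 80895) , (82022 , 63693)))))) ∷
      ((((((0 , 56927) , (21745 , 61869)) , ((56514 , 52357) , (78299 , 18935)))
      , (((16734 , 73549) , (53342 , 90340)) , ((91043 , 60977) , (86208 , 28120))))
      , ((((30249 , 31435) , (40615 , 60084)) , ((75785 , 48878) , (69098 , 86966)))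
      , (((26559 , 2822) , (42093 , 32289)) , ((94986 , 69009) , (76770 , 40192)))))
      , (((((67083 , 389) , (11832 , 69263)) , ((5578 , 48010) , (53702 , 45546)))
      , (((50899 , 75550) , (94623 , 25204)) , ((64768 , 70143) , (25255 , 19138))))
      , ((((58413 , 14084) , (72946 , 77934)) , ((48605 , 54273) , (12176 , 68895)))
      , (((27601 , 10012) , (35514 , 50677)) , ((23785 , 4405) , (81925 , 71304)))))) ∷
      ((((((0 , 82117) , (51771 , 17507)) , ((54065 , 84991) , (6132 , 18935)))
      , (((47079 , 58961) , (9734 , 80333)) , ((30089 , 35942) , (74059 , 94160))))
      , ((((90018 , 62186) , (56220 , 63035)) , ((29484 , 54635) , (32378 , 3071)))
      , (((74617 , 41580) , (3474 , 94731)) , ((64674 , 18636) , (83034 , 57669)))))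
      , (((((88797 , 11484) , (89570 , 3728)) , ((93221 , 86758) , (68219 , 13671)))
      , (((57271 , 64070) , (45200 , 4885)) , ((56314 , 56112) , (7660 , 2817))))
      , ((((94872 , 45071) , (15567 , 77679)) , ((4399 , 69425) , (40863 , 29718)))
      , (((72579 , 87163) , (46730 , 12847)) , ((92375 , 20720) , (71465 , 57534)))))) ∷
      ((((((0 , 3832) , (62507 , 67861)) , ((91378 , 92526) , (8190 , 79803)))
      , (((15204 , 22157) , (96147 , 89158)) , ((12014 , 39047) , (31619 , 89839))))
      , ((((48024 , 94948) , (82708 , 62115)) , ((45220 , 53837) , (54036 , 6612)))
      , (((42490 , 63002) , (43980 , 19463)) , ((2458 , 78317) , (52693 , 21191)))))
      , (((((93319 , 87036) , (67607 , 49930)) , ((96932 , 81239) , (10140 , 53961)))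
      , (((26563 , 41348) , (88118 , 19793)) , ((62803 , 49502) , (96890 , 85986))))
      , ((((41218 , 25400) , (74621 , 26863)) , ((8756 , 95263) , (60588 , 20998)))
      , (((32982 , 11507) , (11128 , 1692)) , ((32703 , 5238) , (34768 , 83548)))))) ∷
      ((((((0 , 17011) , (63908 , 17876)) , ((55238 , 93671) , (42488 , 6788)))
      , (((96629 , 54086) , (44711 , 1360)) , ((12266 , 54401) , (76363 , 54649))))
      , ((((47333 , 14434) , (25271 , 68426)) , ((23251 , 13450) , (78116 , 94871)))
      , (((73211 , 58412) , (79546 , 36526)) , ((39549 , 28880) , (76778 , 38846)))))
      , (((((66301 , 30116) , (74691 , 36878)) , ((95201 , 24621) , (2452 , 41466)))
      , (((50321 , 71691) , (49358 , 51158)) , ((64601 , 68110) , (12650 , 24693))))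
      , ((((67856 , 51987) , (22265 , 93403)) , ((21956 , 24376) , (93866 , 79072)))
      , (((32216 , 24498) , (87229 , 3193)) , ((59237 , 62277) , (86419 , 91703)))))) ∷
      ((((((0 , 68097) , (67772 , 94199)) , ((22700 , 24423) , (31362 , 82818)))
      , (((82749 , 86457) , (27729 , 44475)) , ((87538 , 4322) , (16773 , 13014))))
      , ((((41383 , 61467) , (21102 , 73381)) , ((14859 , 68412) , (29258 , 35456)))
      , (((30659 , 41203) , (28114 , 64256)) , ((42783 , 53705) , (81163 , 47879)))))
      , (((((9458 , 61340) , (1603 , 34368)) , ((76034 , 92751) , (44820 , 58287)))
      , (((7152 , 76570) , (82688 , 75298)) , ((94678 , 47087) , (7660 , 10940))))
      , ((((30867 , 37023) , (16077 , 60690)) , ((95698 , 54126) , (58593 , 12507)))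
      , (((39978 , 73912) , (63405 , 91212)) , ((69533 , 37301) , (85766 , 30003)))))) ∷
      ((((((0 , 73042) , (85170 , 83547)) , ((36857 , 37548) , (36530 , 319)))
      , (((44467 , 44532) , (86908 , 69521)) , ((35189 , 60500) , (59151 , 92982))))
      , ((((44370 , 52269) , (20881 , 96668)) , ((92363 , 84024) , (23518 , 91535)))
      , (((9130 , 6135) , (40450 , 16826)) , ((56509 , 50295) , (74112 , 73693)))))
      , (((((7905 , 88095) , (91779 , 28977)) , ((24952 , 54563) , (24290 , 20301)))
      , (((60066 , 96277) , (23093 , 66595)) , ((95337 , 26307) , (56930 , 35675))))
      , ((((27447 , 12689) , (31875 , 77679)) , ((27948 , 43092) , (50230 , 81972)))
      , (((56610 , 42617) , (26831 , 1182)) , ((88732 , 3570) , (74270 , 22602)))))) ∷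
      ((((((0 , 85426) , (82876 , 90181)) , ((47941 , 33205) , (37770 , 54571)))
      , (((77266 , 32191) , (80577 , 90839)) , ((90516 , 26911) , (49922 , 69694))))
      , ((((34911 , 96391) , (18397 , 55153)) , ((50660 , 2700) , (59335 , 29071)))
      , (((4415 , 24807) , (30010 , 11253)) , ((19243 , 12238) , (74283 , 61699)))))
      , (((((35956 , 76417) , (43175 , 25675)) , ((40465 , 76707) , (61268 , 78951)))
      , (((78265 , 17165) , (44290 , 82445)) , ((85929 , 17005) , (21494 , 8078))))
      , ((((3489 , 40544) , (48621 , 39140)) , ((40370 , 5816) , (52780 , 93076)))
      , (((4000 , 92983) , (22758 , 92740)) , ((10787 , 83960) , (76867 , 36210)))))) ∷
      ((((((0 , 3832) , (39276 , 31651)) , ((11735 , 60268) , (14778 , 14356)))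
      , (((79309 , 28736) , (81516 , 48203)) , ((20737 , 90767) , (28304 , 52028))))
      , ((((12923 , 78879) , (9356 , 94344)) , ((13345 , 44036) , (16241 , 66028)))
      , (((63910 , 72801) , (83468 , 11595)) , ((69281 , 79648) , (84222 , 54739)))))
      , (((((85427 , 64583) , (82315 , 36218)) , ((63613 , 91288) , (19388 , 32073)))
      , (((89983 , 70418) , (65176 , 27971)) , ((22610 , 92063) , (40043 , 31340))))
      , ((((39993 , 29480) , (76963 , 63401)) , ((50156 , 39611) , (85258 , 40719)))
      , (((36385 , 4422) , (62382 , 60601)) , ((9523 , 32958) , (95801 , 36298)))))) ∷
      ((((((0 , 54825) , (52530 , 30631)) , ((12920 , 88285) , (88570 , 48535)))
      , (((48450 , 9433) , (93330 , 89666)) , ((48021 , 66385) , (41770 , 48620))))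
      , ((((12750 , 46480) , (31502 , 89581)) , ((12835 , 39355) , (23518 , 48106)))
      , (((89751 , 95880) , (4334 , 48191)) , ((30801 , 68400) , (23028 , 30716)))))
      , (((((39270 , 88370) , (95965 , 93500)) , ((88455 , 46565) , (66470 , 4249)))
      , (((31417 , 93415) , (23603 , 66300)) , ((52700 , 23113) , (52615 , 68570))))
      , ((((54995 , 54910) , (68485 , 23198)) , ((46650 , 39440) , (9263 , 41685)))
      , (((88485 , 41600) , (31587 , 96050)) , ((23688 , 4164) , (88655 , 9348)))))) ∷ []

  offset₁ offset₂ : Fin 43 → V 6
  offset₁ r = drop 2 (exp (proj₁ (planeExps r)))
  offset₂ r = drop 2 (exp (proj₂ (planeExps r)))

planeBasis : Fin 43 → Vec (V 8) 2
planeBasis r = (I ∷ O ∷ offset₁ r) ∷ (O ∷ I ∷ offset₂ r) ∷ []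

spaceBasis : Fin 43 → V 6 → Vec (V 8) 3
spaceBasis r y = reduced (offset₁ r) (offset₂ r) y

repBasis : Fin 3 → Fin 127 → Vec (V 8) 3
repBasis i m = map exp (triple (repExps i m))

abstract
  -- Mixed-radix decoding. Reduction modulo 127 in `codeRep` strips the class; in `codePlane` and
  -- `codeColour` the quotients of the table entries are already in range, and `_mod_` places them
  -- in `Fin`.
  codePlane : ℕ → Fin 43
  codePlane c = (c / 255) mod 43

  codeColour : ℕ → Fin 3
  codeColour c = (c / (127 * 255)) mod 3

  codeRep : ℕ → Fin 127
  codeRep c = (c / 255) mod 127

colour : Fin 43 → V 6 → Fin 3
colour r y = codeColour (spaceCode r y)

-- Each table carries the filler 0 at `𝟎`, which would decode to the first class; the condition
-- `y ≢ 𝟎` keeps it out of the count.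
Coloured : Fin 43 → Fin 3 → Pred (V 6) 0ℓ
Coloured r i y = y ≢ 𝟎 × colour r y ≡ i

coloured? : ∀ r i → Decidable (Coloured r i)
coloured? r i y = ¬? (y ≟ᵥ 𝟎) ×-dec (colour r y Fin.≟ i)

abstract
  planeBasis-exp : ∀ r → planeBasis r ≡ map exp (pair (planeExps r))
  planeBasis-exp = toWitness
    {a? = Fin.all? λ r → Vec.≡-dec _≟ᵥ_ (planeBasis r) (map exp (pair (planeExps r)))} _

  planeCode-hits : ∀ x → x ≢ 𝟎 →
    Hits (planeCode x) (pair (planeExps (codePlane (planeCode x)))) (Logs (exp 0 ∷ (O ∷ x) ∷ []))
  planeCode-hits = toWitness {a? = allV? λ x → ¬? (x ≟ᵥ 𝟎) →-dec
    hits? (planeCode x) (pair (planeExps (codePlane (planeCode x)))) (Logs (exp 0 ∷ (O ∷ x) ∷ []))} _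

  spaceCode-hits : ∀ r y → y ≢ 𝟎 →
    Hits (spaceCode r y) (triple (repExps (colour r y) (codeRep (spaceCode r y)))) (Logs (spaceBasis r y))
  spaceCode-hits = toWitness {a? = Fin.all? λ r → allV? λ y → ¬? (y ≟ᵥ 𝟎) →-dec
    hits? (spaceCode r y) (triple (repExps (colour r y) (codeRep (spaceCode r y))))
          (Logs (spaceBasis r y))} _

  -- These are the Kramer-Mesner equations: in the row of plane `r`, the entries belonging to the
  -- orbits of class `i` add up to 21.
  coloured-count : ∀ r i → List.length (List.filter (coloured? r i) (allVectors 6)) ≡ 21
  coloured-count = toWitness {a? = Fin.all? λ r → Fin.all? λ i →
    List.length (List.filter (coloured? r i) (allVectors 6)) ℕ.≟ 21} _

  repExps<255 : ∀ i m → proj₁ (repExps i m) < 255 × proj₂ (repExps i m) < 255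
  repExps<255 = toWitness {a? = Fin.all? λ i → Fin.all? λ m →
    (proj₁ (repExps i m) ℕ.<? 255) ×-dec (proj₂ (repExps i m) ℕ.<? 255)} _

  repBasis-independent : ∀ i m → Independent (repBasis i m)
  repBasis-independent = toWitness {a? = Fin.all? λ i → Fin.all? λ m → independent? (repBasis i m)} _

  rep-lexMin : ∀ i m → LexMin (repExps i m) (Logs (repBasis i m))
  rep-lexMin = toWitness {a? = Fin.all? λ i → Fin.all? λ m →
    lexMin? (repExps i m) (Logs (repBasis i m))} _

  repTable-unique : Unique repTable
  repTable-unique = toWitness
    {a? = AllPairs.allPairs? (λ p q → ¬? (Product.≡-dec ℕ._≟_ ℕ._≟_ p q)) repTable} _

  -- The table lists all three classes in succession, so one check for repetitions separates
  -- representatives both within a class and across classes.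
  repExps-injective : ∀ i m i′ m′ → repExps i m ≡ repExps i′ m′ → i ≡ i′ × m ≡ m′
  repExps-injective i m i′ m′ eq = Fin.combine-injective i m i′ m′
    (Unique.lookup-injective repTable-unique (combine i m) (combine i′ m′) eq)

-- Planes and the 3-subspaces above them

lincomb-plane : ∀ c d (a b : V n) →
  lincomb (c ∷ d ∷ []) ((I ∷ O ∷ a) ∷ (O ∷ I ∷ b) ∷ []) ≡ c ∷ d ∷ (c ⊙ a ⊕ d ⊙ b)
lincomb-plane O O a b = cong (λ z → O ∷ O ∷ (O ⊙ a ⊕ z)) (⊕-identityʳ (O ⊙ b))
lincomb-plane O I a b = cong (λ z → O ∷ I ∷ (O ⊙ a ⊕ z)) (⊕-identityʳ (I ⊙ b))
lincomb-plane I O a b = cong (λ z → I ∷ O ∷ (I ⊙ a ⊕ z)) (⊕-identityʳ (O ⊙ b))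
lincomb-plane I I a b = cong (λ z → I ∷ I ∷ (I ⊙ a ⊕ z)) (⊕-identityʳ (I ⊙ b))

plane : Fin 43 → Subspace 2 8
plane r = span (planeBasis r) λ { (c ∷ d ∷ []) eq →
  cong (take 2) (trans (sym (lincomb-plane c d (offset₁ r) (offset₂ r))) eq) }

-- Dividing by the basis vector `t` makes the plane contain 1 = `exp 0`. Adding 1, if necessary, to
-- the other quotient clears its first coordinate. This leaves the 127 planes ⟨1, (0,x)⟩ listed in
-- `planeCode`.
plane-translate : (T : Subspace 2 8) →
  ∃[ r ] ∃[ g ] g ∈ G × carrier T ≐ image g (carrier (plane r))
plane-translate T with vectors (basis T) | members (basis T) | independent (basis T)
... | t ∷ u ∷ [] | t∈T ∷ u∈T ∷ [] | ind =
  r , pow i ∙ pow j , mul (pow∈G i) (pow∈G j) ,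
  ≐-trans (image-⁻¹ (pow i ⁻¹) {W = carrier T} ≐-refl)
  (≐-trans (image-cong (pow i) (≐-sym (⊆⇒≐ complete-2 (translate (pow j) (plane r)) T′ ⊆T′)))
           (≐-sym (image-∙ (pow i) (pow j))))
  where
  t≢𝟎 : t ≢ 𝟎
  t≢𝟎 refl with () ← ind (I ∷ O ∷ []) (trans (cong₂ _⊕_ (⊙𝟎 I) (⊕-identityʳ (O ⊙ u)))
                       (trans (⊕-identityˡ (O ⊙ u)) (O⊙ u)))
  u≢𝟎 : u ≢ 𝟎
  u≢𝟎 refl with () ← ind (O ∷ I ∷ []) (trans (cong₂ _⊕_ (O⊙ t) (⊕-identityʳ (I ⊙ u)))
                       (trans (⊕-identityˡ (I ⊙ u)) (⊙𝟎 I)))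
  t≢u : t ≢ u
  t≢u refl with () ← ind (I ∷ I ∷ []) (trans (cong (I ⊙ t ⊕_) (⊕-identityʳ (I ⊙ t)))
                       (⊕-self (I ⊙ t)))
  i = log t
  -- An exponent of the quotient u / t, left unreduced; adding 255 replaces a negative difference.
  l = log u + (255 ∸ i)
  i+l : i + l ≡ log u + 255
  i+l = begin
    i + (log u + (255 ∸ i)) ≡⟨ ℕ.+-comm i l ⟩
    log u + (255 ∸ i) + i   ≡⟨ ℕ.+-assoc (log u) (255 ∸ i) i ⟩
    log u + (255 ∸ i + i)   ≡⟨ cong (log u +_) (ℕ.m∸n+n≡m (ℕ.<⇒≤ (log<255 t t≢𝟎))) ⟩
    log u + 255             ∎
    where open ≡-Reasoning
  pow-0 : mat (pow i) *ᵥ exp 0 ≡ t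
  pow-0 = trans (pow-exp i 0) (trans (cong exp (ℕ.+-identityʳ i)) (exp-log t t≢𝟎))
  pow-l : mat (pow i) *ᵥ exp l ≡ u
  pow-l = begin
    mat (pow i) *ᵥ exp l       ≡⟨ pow-exp i l ⟩
    exp (i + l)                ≡⟨ cong exp i+l ⟩
    exp (log u + 255)          ≡⟨ exp-% (log u + 255) ⟨
    exp ((log u + 255) % 255)  ≡⟨ cong exp ([m+n]%n≡m%n (log u) 255) ⟩
    exp (log u % 255)          ≡⟨ exp-% (log u) ⟩
    exp (log u)                ≡⟨ exp-log u u≢𝟎 ⟩
    u                          ∎
    where open ≡-Reasoning
  T′ : Subspace 2 8
  T′ = translate (pow i ⁻¹) T
  pull : ∀ v {w} → w ∈ carrier T → mat (pow i) *ᵥ v ≡ w → v ∈ carrier T′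
  pull v {w} w∈T eq = w , w∈T , sym (trans (cong (mat⁻ (pow i) *ᵥ_) (sym eq))
    (*ᵥ-cancel (mat⁻ (pow i)) (mat (pow i)) (invˡ (pow i)) v))
  x : V 7
  x = tail (exp l)
  O∷x : ∀ v → v ∈ carrier T′ → (O ∷ tail v) ∈ carrier T′
  O∷x (O ∷ v) v∈ = v∈
  O∷x (I ∷ v) v∈ = subst (λ z → (O ∷ z) ∈ carrier T′) (⊕-identityʳ v)
    (IsSubspace.⊕-closed (isSubspace T′) v∈ (pull (exp 0) t∈T pow-0))
  -- If `x` vanished, `exp l` would be zero, which no power is, or 1, which means `t ≡ u`.
  x≢𝟎 : x ≢ 𝟎
  x≢𝟎 x≡𝟎 with exp l in eq
  ... | O ∷ _ = exp≢𝟎 l (trans eq (cong (O ∷_) x≡𝟎))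
  ... | I ∷ _ = t≢u (trans (sym pow-0) (trans (cong (mat (pow i) *ᵥ_) (sym (trans eq (cong (I ∷_) x≡𝟎))))
                                               pow-l))
  j = planeCode x
  r : Fin 43
  r = codePlane j
  basis∈T′ : All (_∈ carrier T′) (exp 0 ∷ (O ∷ x) ∷ [])
  basis∈T′ = pull (exp 0) t∈T pow-0 ∷ O∷x (exp l) (pull (exp l) u∈T pow-l) ∷ []
  ⊆T′ : image (pow j) (carrier (plane r)) ⊆ carrier T′
  ⊆T′ = subst (λ vs → image (pow j) (Span vs) ⊆ carrier T′) (sym (planeBasis-exp r))
    (exp∈⇒image⊆ j (isSubspace T′)
      (All.map (Span⊆ (isSubspace T′) basis∈T′) (hits⇒exp∈ j _ (planeCode-hits x x≢𝟎))))

module _ (a b : V n) where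

  lincomb-reduced : ∀ c d e y →
    lincomb (c ∷ d ∷ e ∷ []) (reduced a b y) ≡ c ∷ d ∷ (c ⊙ a ⊕ (d ⊙ b ⊕ e ⊙ y))
  lincomb-reduced c d e y = cong₂ _∷_ (first c d e) (cong₂ _∷_ (second c d e)
    (cong (λ z → c ⊙ a ⊕ (d ⊙ b ⊕ z)) (⊕-identityʳ (e ⊙ y))))
    where
    first : ∀ c d e → (c ∧ I) xor ((d ∧ O) xor ((e ∧ O) xor O)) ≡ c
    first c d e rewrite Bool.∧-identityʳ c | Bool.∧-zeroʳ d | Bool.∧-zeroʳ e = Bool.xor-identityʳ c
    second : ∀ c d e → (c ∧ O) xor ((d ∧ I) xor ((e ∧ O) xor O)) ≡ d
    second c d e rewrite Bool.∧-zeroʳ c | Bool.∧-identityʳ d | Bool.∧-zeroʳ e = Bool.xor-identityʳ d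

  -- The pivots make the first two coefficients visible as the first two coordinates, so both must
  -- be zero.
  lincomb-OO : ∀ c y {z} → lincomb c (reduced a b y) ≡ O ∷ O ∷ z → ∃[ e ] c ≡ O ∷ O ∷ e ∷ [] × e ⊙ y ≡ z
  lincomb-OO (c ∷ d ∷ e ∷ []) y eq
    with refl ← trans (sym eq) (lincomb-reduced c d e y) =
    e , refl , sym (trans (cong₂ _⊕_ (O⊙ a) (trans (cong (_⊕ e ⊙ y) (O⊙ b)) (⊕-identityˡ _))) (⊕-identityˡ _))

  reduced-independent : ∀ y → y ≢ 𝟎 → Independent (reduced a b y)
  reduced-independent y y≢𝟎 c eq with lincomb-OO c y eq
  ... | O , refl , _  = refl
  ... | I , _    , y≡ = contradiction (trans (sym (I⊙ y)) y≡) y≢𝟎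

  -- Among the vectors with two leading zeros the span contains only zero and (0,0,y). Different `y`
  -- therefore give different 3-subspaces, which later makes the 21 blocks distinct.
  reduced-injective : ∀ y {z} → z ≢ 𝟎 → (O ∷ O ∷ z) ∈ Span (reduced a b y) → z ≡ y
  reduced-injective y z≢𝟎 (c , eq) with lincomb-OO c y eq
  ... | O , _ , z≡ = contradiction (trans (sym z≡) (O⊙ y)) z≢𝟎
  ... | I , _ , z≡ = trans (sym z≡) (I⊙ y)

  -- Reduction modulo the plane: adding c (1,0,a) + d (0,1,b) clears the two leading coordinates,
  -- and the remaining ones are kept.
  residue : V (suc (suc n)) → V n
  residue (c ∷ d ∷ z) = z ⊕ (c ⊙ a ⊕ d ⊙ b)

  residue∈ : {W : Pred (V (suc (suc n))) 0ℓ} → IsSubspace W →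
             (I ∷ O ∷ a) ∈ W → (O ∷ I ∷ b) ∈ W → ∀ {v} → v ∈ W → (O ∷ O ∷ residue v) ∈ W
  residue∈ {W} sub s∈W t∈W {c ∷ d ∷ z} v∈W = subst W
    (trans (cong ((c ∷ d ∷ z) ⊕_) (lincomb-plane c d a b))
           (cong₂ (λ x y → x ∷ y ∷ (z ⊕ (c ⊙ a ⊕ d ⊙ b))) (Bool.xor-same c) (Bool.xor-same d)))
    (IsSubspace.⊕-closed sub v∈W (lincomb-closed sub (s∈W ∷ t∈W ∷ []) (c ∷ d ∷ [])))

  residue≡𝟎 : ∀ y v → residue v ≡ 𝟎 → v ∈ Span (reduced a b y)
  residue≡𝟎 y (c ∷ d ∷ z) eq = c ∷ d ∷ O ∷ [] , trans (lincomb-reduced c d O y)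
    (cong (λ z → c ∷ d ∷ z) (begin
      c ⊙ a ⊕ (d ⊙ b ⊕ O ⊙ y)                ≡⟨ cong (λ x → c ⊙ a ⊕ (d ⊙ b ⊕ x)) (O⊙ y) ⟩
      c ⊙ a ⊕ (d ⊙ b ⊕ 𝟎)                    ≡⟨ cong (c ⊙ a ⊕_) (⊕-identityʳ (d ⊙ b)) ⟩
      s                                      ≡⟨ ⊕-identityˡ s ⟨
      𝟎 ⊕ s                                  ≡⟨ cong (_⊕ s) eq ⟨
      (z ⊕ s) ⊕ s                            ≡⟨ ⊕-assoc z s s ⟩
      z ⊕ (s ⊕ s)                            ≡⟨ cong (z ⊕_) (⊕-self s) ⟩
      z ⊕ 𝟎                                  ≡⟨ ⊕-identityʳ z ⟩
      z                                      ∎))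
    where
    open ≡-Reasoning
    s = c ⊙ a ⊕ d ⊙ b

  -- A basis vector of `K` with nonzero residue supplies `y`. If all residues vanish, `K` lies in
  -- the span belonging to the arbitrary `y₀` and equals it by dimension, so this case also delivers
  -- an answer instead of having to be refuted.
  extension : {y₀ : V n} → y₀ ≢ 𝟎 → (K : Subspace 3 (suc (suc n))) →
              (I ∷ O ∷ a) ∈ carrier K → (O ∷ I ∷ b) ∈ carrier K →
              ∃[ y ] y ≢ 𝟎 × carrier K ≐ Span (reduced a b y)
  extension {y₀} y₀≢𝟎 K s∈K t∈K with search (members (basis K))
    where
    search : ∀ {k} {vs : Vec (V (suc (suc n))) k} → All (_∈ carrier K) vs →
             (∃[ v ] v ∈ carrier K × residue v ≢ 𝟎) ⊎ All (_∈ Span (reduced a b y₀)) vs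
    search [] = inj₂ []
    search (_∷_ {x = v} v∈K vs∈K) with residue v ≟ᵥ 𝟎 | search vs∈K
    ... | no ≢𝟎  | _         = inj₁ (v , v∈K , ≢𝟎)
    ... | yes _  | inj₁ w    = inj₁ w
    ... | yes ≡𝟎 | inj₂ vs∈  = inj₂ (residue≡𝟎 y₀ v ≡𝟎 ∷ vs∈)
  ... | inj₁ (v , v∈K , ≢𝟎) = residue v , ≢𝟎 ,
    ≐-sym (⊆⇒≐ complete-3 (span (reduced a b (residue v)) (reduced-independent _ ≢𝟎)) K
      (Span⊆ (isSubspace K) (s∈K ∷ t∈K ∷ residue∈ (isSubspace K) s∈K t∈K v∈K ∷ [])))
  ... | inj₂ vs∈ = y₀ , y₀≢𝟎 ,
    ⊆⇒≐ complete-3 K (span (reduced a b y₀) (reduced-independent _ y₀≢𝟎))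
      (λ w∈K → Span⊆ (span-isSubspace (reduced a b y₀)) vs∈ (⊆Span K w∈K))

-- The three classes and their members

space : Fin 43 → (y : V 6) → y ≢ 𝟎 → Subspace 3 8
space r y y≢𝟎 = span (spaceBasis r y) (reduced-independent (offset₁ r) (offset₂ r) y y≢𝟎)

plane⊆space : ∀ r y y≢𝟎 → carrier (plane r) ⊆ carrier (space r y y≢𝟎)
plane⊆space r y y≢𝟎 with span-members (spaceBasis r y)
... | s ∷ t ∷ _ = Span⊆ (span-isSubspace (spaceBasis r y)) (s ∷ t ∷ [])

rep : Fin 3 → Fin 127 → Subspace 3 8
rep i m = span (repBasis i m) (repBasis-independent i m)

-- With classes defined as unions of orbits, invariance under `G` follows from transitivity of the
-- orbit relation. The work lies in finding the class of a given 3-subspace and showing that it is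
-- the only one.
B : Fin 3 → Pred (Subspace 3 8) 0ℓ
B i = ⋃ (Fin 127) (λ m → Orbit G (rep i m))

space∈B : ∀ r y y≢𝟎 → space r y y≢𝟎 ∈ B (colour r y)
space∈B r y y≢𝟎 = μ , pow c , pow∈G c ,
  ≐-sym (⊆⇒≐ complete-3 (translate (pow c) (rep (colour r y) μ)) (space r y y≢𝟎)
    (exp∈⇒image⊆ c (span-isSubspace (spaceBasis r y))
      (hits⇒exp∈ c (spaceBasis r y) (spaceCode-hits r y y≢𝟎))))
  where
  c = spaceCode r y
  μ : Fin 127
  μ = codeRep c

B-trans : ∀ i (K L : Subspace 3 8) → K ∈ B i → Orbit G K L → L ∈ B i
B-trans i K L (m , o) o′ = m , orbit-trans (rep i m) K L o o′

⊇plane⇒space : ∀ r (K : Subspace 3 8) → carrier (plane r) ⊆ carrier K →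
  Σ[ y ∈ V 6 ] Σ[ y≢𝟎 ∈ y ≢ 𝟎 ] carrier K ≐ carrier (space r y y≢𝟎)
⊇plane⇒space r K ⊆K with span-members (planeBasis r)
-- `I ∷ 𝟎` is an arbitrary nonzero choice of the default `y₀`.
... | s ∷ t ∷ [] = extension (offset₁ r) (offset₂ r) {I ∷ 𝟎} (λ ()) K (⊆K s) (⊆K t)

-- The first two basis vectors span a plane inside `K`. Moving it to one of the 43 representatives
-- moves `K` to a tabulated 3-subspace, and moving back stays within the class.
covering : ∀ K → K ∈ ⋃ (Fin 3) B
covering K with vectors (basis K) | members (basis K) | independent (basis K)
... | u ∷ v ∷ w ∷ [] | u∈K ∷ v∈K ∷ _ | ind =
  colour r y , B-trans (colour r y) S K (space∈B r y y≢𝟎)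
    (g , g∈G , ≐-trans (image-⁻¹ (g ⁻¹) {W = carrier K} ≐-refl) (image-cong g K′≐))
  where
  T = span (u ∷ v ∷ []) (initial-independent u v w ind)
  r = proj₁ (plane-translate T)
  g = proj₁ (proj₂ (plane-translate T))
  g∈G = proj₁ (proj₂ (proj₂ (plane-translate T)))
  T≐ : carrier T ≐ image g (carrier (plane r))
  T≐ = proj₂ (proj₂ (proj₂ (plane-translate T)))
  K′ = translate (g ⁻¹) K
  plane⊆K′ : carrier (plane r) ⊆ carrier K′
  plane⊆K′ x∈ = image-mono (g ⁻¹) {carrier T} {carrier K} (Span⊆ (isSubspace K) (u∈K ∷ v∈K ∷ []))
    (proj₁ (image-⁻¹ g T≐) x∈)
  above = ⊇plane⇒space r K′ plane⊆K′
  y = proj₁ above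
  y≢𝟎 = proj₁ (proj₂ above)
  K′≐ = proj₂ (proj₂ above)
  S = space r y y≢𝟎

-- Distinctness of the orbits

log≤255 : ∀ v → log v ≤ 255
log≤255 v with v ≟ᵥ 𝟎
... | yes refl = ℕ.≤-reflexive log-𝟎
... | no  v≢𝟎  = ℕ.<⇒≤ (log<255 v v≢𝟎)

-- The congruence k + z ≡ 0 eliminates the unknown translation exponent `k`: then k + x becomes x -
-- z.
%-difference : ∀ k x z e → z ≤ 255 → (k + z) % 255 ≡ 0 → e < 255 → e % 255 ≡ (k + x) % 255 →
               e ≡ (x + (255 ∸ z)) % 255
%-difference k x z e z≤ k+z e< e% = begin
  e                                                       ≡⟨ m<n⇒m%n≡m e< ⟨
  e % 255                                                 ≡⟨ e% ⟩
  (k + x) % 255                                           ≡⟨ [m+n]%n≡m%n (k + x) 255 ⟨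
  (k + x + 255) % 255                                     ≡⟨ cong (_% 255) rearrange ⟩
  ((k + z) + (x + (255 ∸ z))) % 255                       ≡⟨ %-distribˡ-+ (k + z) (x + (255 ∸ z)) 255 ⟩
  ((k + z) % 255 + (x + (255 ∸ z)) % 255) % 255           ≡⟨
    cong (λ t → (t + (x + (255 ∸ z)) % 255) % 255) k+z ⟩
  (x + (255 ∸ z)) % 255 % 255                             ≡⟨ m%n%n≡m%n (x + (255 ∸ z)) 255 ⟩
  (x + (255 ∸ z)) % 255                                   ∎
  where
  open ≡-Reasoning
  rearrange : k + x + 255 ≡ (k + z) + (x + (255 ∸ z))
  rearrange = begin
    k + x + 255                  ≡⟨ cong (k + x +_) (ℕ.m+[n∸m]≡n z≤) ⟨
    k + x + (z + (255 ∸ z))      ≡⟨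
      solve 4 (λ k x z w → k :+ x :+ (z :+ w) := (k :+ z) :+ (x :+ w)) refl k x z (255 ∸ z) ⟩
    (k + z) + (x + (255 ∸ z))    ∎
    where open +-*-Solver

Lex : ℕ × ℕ → ℕ × ℕ → Set
Lex (a , b) (a′ , b′) = a < a′ ⊎ (a ≡ a′ × b ≤ b′)

module _ {i m i′ m′} (k : ℕ) (eq : carrier (rep i′ m′) ⊆ image (pow k) (carrier (rep i m))) where
  private
    vs = repBasis i m
    L = Logs vs
    us = repBasis i′ m′
    a = proj₁ (repExps i m)
    b = proj₂ (repExps i m)
    a′ = proj₁ (repExps i′ m′)
    b′ = proj₂ (repExps i′ m′)

    f : V 3 → V 8
    f c = mat (pow k) *ᵥ lincomb c vs

    preimages : All (λ e → ∃[ c ] exp e ≡ f c) (triple (repExps i′ m′))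
    preimages = All.map (λ e∈ → pre (eq e∈)) (All.map⁻ (span-members us))
      where
      pre : ∀ {v} → v ∈ image (pow k) (Span vs) → ∃[ c ] v ≡ f c
      pre (x , (c , refl) , v≡) = c , v≡

    log-preimage : ∀ e c → exp e ≡ f c → e % 255 ≡ (k + L ! c) % 255
    log-preimage e c e≡ = begin
      e % 255               ≡⟨ log-exp e ⟨
      log (exp e)           ≡⟨ cong log e≡ ⟩
      log (f c)             ≡⟨ cong (log ∘ (mat (pow k) *ᵥ_)) (exp-log v v≢𝟎) ⟨
      log (mat (pow k) *ᵥ exp (log v)) ≡⟨ cong log (pow-exp k (log v)) ⟩
      log (exp (k + log v)) ≡⟨ log-exp (k + log v) ⟩
      (k + log v) % 255     ≡⟨ cong (λ l → (k + l) % 255) (tabulate-! (λ c → log (lincomb c vs)) c) ⟨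
      (k + L ! c) % 255     ∎
      where
      open ≡-Reasoning
      v = lincomb c vs
      v≢𝟎 : v ≢ 𝟎
      v≢𝟎 v≡𝟎 = exp≢𝟎 e (trans e≡ (trans (cong (mat (pow k) *ᵥ_) v≡𝟎) (*ᵥ-𝟎 (mat (pow k)))))

    L≤ : ∀ c → L ! c ≤ 255
    L≤ c = subst (_≤ 255) (sym (tabulate-! (λ c → log (lincomb c vs)) c)) (log≤255 (lincomb c vs))

    -- The map `f` is linear, so a relation among coordinate vectors carries over to their images.
    -- `LexMin` speaks only of independent coordinate vectors, hence the need to pull independence
    -- back.
    f-independent : ∀ {n} {cs : Vec (V 3) n} {ws} → map f cs ≡ ws → Independent ws → Independent cs
    f-independent {cs = cs} refl ind d d≡𝟎 = ind d (begin
      lincomb d (map f cs)                                 ≡⟨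
        cong (lincomb d) (Vec.map-∘ (mat (pow k) *ᵥ_) (λ c → lincomb c vs) cs) ⟩
      lincomb d (map (mat (pow k) *ᵥ_) (cs *ₘ vs))         ≡⟨ *ᵥ-lincomb (mat (pow k)) d (cs *ₘ vs) ⟨
      mat (pow k) *ᵥ lincomb d (cs *ₘ vs)                  ≡⟨ cong (mat (pow k) *ᵥ_) (lincomb-lincomb d cs vs) ⟨
      mat (pow k) *ᵥ lincomb (lincomb d cs) vs             ≡⟨ cong f d≡𝟎 ⟩
      mat (pow k) *ᵥ lincomb 𝟎 vs                          ≡⟨ cong (mat (pow k) *ᵥ_) (lincomb-𝟎 vs) ⟩
      mat (pow k) *ᵥ 𝟎                                     ≡⟨ *ᵥ-𝟎 (mat (pow k)) ⟩
      𝟎                                                    ∎)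
      where open ≡-Reasoning

  -- The coordinate vectors `c`, `c₁`, `c₂` carried to 1, αᵃ′, αᵇ′ are among the candidates over
  -- which (a , b) is minimal, and the pair they produce is exactly (a′ , b′).
  translate⇒Lex : Lex (repExps i m) (repExps i′ m′)
  translate⇒Lex with preimages
  ... | (c , c≡) ∷ (c₁ , c₁≡) ∷ (c₂ , c₂≡) ∷ [] = conclude (rep-lexMin i m c c₁ ind₂)
    where
    ind₃ : Independent (c ∷ c₁ ∷ c₂ ∷ [])
    ind₃ = f-independent (cong₂ _∷_ (sym c≡) (cong₂ _∷_ (sym c₁≡) (cong₂ _∷_ (sym c₂≡) refl)))
                         (repBasis-independent i′ m′)
    ind₂ : Independent (c ∷ c₁ ∷ [])
    ind₂ = initial-independent c c₁ c₂ ind₃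
    difference : ∀ e d → e < 255 → exp e ≡ f d → e ≡ L ! d ⊖ L ! c
    difference e d e< e≡ =
      -- The first exponent of the triple is 0, so `c` is carried to 1 and k + `L ! c` ≡ 0 modulo
      -- 255.
      %-difference k (L ! d) (L ! c) e (L≤ c) (sym (log-preimage 0 c c≡)) e< (log-preimage e d e≡)
    a≡ : a′ ≡ L ! c₁ ⊖ L ! c
    a≡ = difference a′ c₁ (proj₁ (repExps<255 i′ m′)) c₁≡
    b≡ : b′ ≡ L ! c₂ ⊖ L ! c
    b≡ = difference b′ c₂ (proj₂ (repExps<255 i′ m′)) c₂≡
    conclude : a < L ! c₁ ⊖ L ! c ⊎ (a ≡ L ! c₁ ⊖ L ! c ×
                 ∀ c₂ → Independent (c ∷ c₁ ∷ c₂ ∷ []) → b ≤ L ! c₂ ⊖ L ! c) →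
               Lex (a , b) (a′ , b′)
    conclude (inj₁ a<) = inj₁ (subst (a <_) (sym a≡) a<)
    conclude (inj₂ (a≡′ , b≤)) = inj₂ (trans a≡′ (sym a≡) , subst (b ≤_) (sym b≡) (b≤ c₂ ind₃))

Lex-antisym : ∀ {p q} → Lex p q → Lex q p → p ≡ q
Lex-antisym (inj₁ a<)       (inj₁ >a)        = contradiction >a (ℕ.<⇒≯ a<)
Lex-antisym (inj₁ a<)       (inj₂ (refl , _)) = contradiction a< (ℕ.<-irrefl refl)
Lex-antisym (inj₂ (refl , _)) (inj₁ >a)      = contradiction >a (ℕ.<-irrefl refl)
Lex-antisym (inj₂ (refl , b≤)) (inj₂ (_ , ≤b)) = cong (_ ,_) (ℕ.≤-antisym b≤ ≤b)

orbit⇒Lex : ∀ i m i′ m′ → Orbit G (rep i m) (rep i′ m′) → Lex (repExps i m) (repExps i′ m′)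
orbit⇒Lex i m i′ m′ (g , g∈G , eq) = let k , g≈ = G⇒pow g∈G in
  translate⇒Lex {i} {m} {i′} {m′} k (λ x∈ → proj₁ (image-resp g (pow k) {carrier (rep i m)} g≈) (proj₁ eq x∈))

-- The orbit relation is symmetric, so each pair is at most the other; equal pairs occupy the same
-- place in the table.
rep-injective : ∀ i m i′ m′ → Orbit G (rep i m) (rep i′ m′) → i ≡ i′ × m ≡ m′
rep-injective i m i′ m′ o = repExps-injective i m i′ m′
  (Lex-antisym (orbit⇒Lex i m i′ m′ o)
               (orbit⇒Lex i′ m′ i m (orbit-sym (rep i m) (rep i′ m′) o)))

B-unique : ∀ {i i′} K → K ∈ B i → K ∈ B i′ → i ≡ i′
B-unique {i} {i′} K (m , o) (m′ , o′) = proj₁ (rep-injective i m i′ m′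
  (orbit-trans (rep i m) K (rep i′ m′) o (orbit-sym (rep i′ m′) K o′)))

-- The large set

abstract
  coloured-enumeration : ∀ r i → Σ[ f ∈ (Fin 21 → V 6) ]
    (∀ j → Coloured r i (f j)) × Injective _≡_ _≡_ f × (∀ {y} → Coloured r i y → ∃[ j ] f j ≡ y)
  coloured-enumeration r i =
    enumerate (coloured? r i) (allVectors-unique 6) allVectors-complete {21} (coloured-count r i)

-- The translation `g` maps the 3-subspaces above the representative plane onto those above `T` and
-- preserves `B i`. The vectors `y` of colour `i` therefore enumerate the blocks above `T`.
balanced : ∀ i (T : Subspace 2 8) →
  HasCardinality (subspaceSetoid 3 8) (λ K → K ∈ B i × carrier T ⊆ carrier K) 21
balanced i T with plane-translate T
... | r , g , g∈G , T≐ with coloured-enumeration r i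
... | f , f-coloured , f-injective , f-surjective = record
  { to        = λ j → block j , block∈B j , T⊆block j
  ; cong      = λ { refl → ≐-refl }
  ; bijective = (λ {j} {j′} → injective j j′) , surjective
  }
  where
  S : Fin 21 → Subspace 3 8
  S j = space r (f j) (proj₁ (f-coloured j))
  block : Fin 21 → Subspace 3 8
  block j = translate g (S j)
  block∈B : ∀ j → block j ∈ B i
  block∈B j = subst (λ i → block j ∈ B i) (proj₂ (f-coloured j))
    (B-trans (colour r (f j)) (S j) (block j)
      (space∈B r (f j) (proj₁ (f-coloured j))) (g , g∈G , ≐-refl))
  T⊆block : ∀ j → carrier T ⊆ carrier (block j)
  T⊆block j x∈T = image-mono g {carrier (plane r)} {carrier (S j)}
    (plane⊆space r (f j) (proj₁ (f-coloured j))) (proj₁ T≐ x∈T)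
  injective : ∀ j j′ → block j ≃ block j′ → j ≡ j′
  injective j j′ (sub , _) with span-members (spaceBasis r (f j))
  ... | _ ∷ _ ∷ y∈ ∷ [] = f-injective (reduced-injective (offset₁ r) (offset₂ r) (f j′)
    (proj₁ (f-coloured j)) (image-cancel g {carrier (S j)} {carrier (S j′)} sub y∈))
  surjective : (K∈ : ∃ λ K → K ∈ B i × carrier T ⊆ carrier K) →
               ∃[ j ] ∀ {j′} → j′ ≡ j → block j′ ≃ proj₁ K∈
  surjective (K , K∈B , T⊆K) = proj₁ found , λ { refl → block≃K }
    where
    K′ = translate (g ⁻¹) K
    above = ⊇plane⇒space r K′ (λ x∈ →
      image-mono (g ⁻¹) {carrier T} {carrier K} T⊆K (proj₁ (image-⁻¹ g T≐) x∈))
    y = proj₁ above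
    y≢𝟎 = proj₁ (proj₂ above)
    K≐ : carrier K ≐ image g (carrier (space r y y≢𝟎))
    K≐ = ≐-trans (image-⁻¹ (g ⁻¹) {W = carrier K} ≐-refl) (image-cong g (proj₂ (proj₂ above)))
    -- The table places the 3-subspace in class `colour r y`; disjointness of the classes identifies
    -- this class with `i`.
    colour≡ : colour r y ≡ i
    colour≡ = B-unique K (B-trans (colour r y) (space r y y≢𝟎) K (space∈B r y y≢𝟎) (g , g∈G , K≐)) K∈B
    found = f-surjective (y≢𝟎 , colour≡)
    block≃K : block (proj₁ found) ≃ K
    block≃K = ≐-trans (subst (λ y′ → image g (Span (spaceBasis r y′)) ≐ image g (Span (spaceBasis r y)))
                             (sym (proj₂ found)) ≐-refl) (≐-sym K≐)

admits : ∀ i → AdmitsAutomorphisms G (B i)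
admits i {g} g∈G =
  (λ { {L} (K , K∈B , L≐) → B-trans i K L K∈B (g , g∈G , L≐) }) ,
  (λ {L} L∈B → translate (g ⁻¹) L ,
     B-trans i L (translate (g ⁻¹) L) L∈B (g ⁻¹ , inv g∈G , ≐-refl) ,
     image-⁻¹ (g ⁻¹) {W = carrier L} ≐-refl)

consistsOfOrbits : ∀ i → ConsistsOfOrbits G 127 (B i)
consistsOfOrbits i = record
  { rep      = rep i
  ; distinct = λ {m} {m′} m≢m′ eq → m≢m′ (sym (proj₂ (rep-injective i m′ i m
      (proj₁ eq {rep i m} (orbit-refl (rep i m) (rep i m) ≐-refl)))))
  ; union    = (λ K∈B → K∈B) , (λ K∈B → K∈B)
  }

largeSet : IsLargeSet 3 2 3 8 21 B
largeSet = record
  { designs  = λ i → record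
    { respects = λ {K} {L} K≃L K∈B → B-trans i K L K∈B (orbit-refl K L (≐-sym K≃L))
    ; balanced = balanced i
    }
  -- Classes are nonempty: the first representative of class `i` would also belong to class `j`.
  ; distinct = λ {i} {j} eq → B-unique {i} {j} (rep i zero) (rep∈B i) (proj₁ eq {rep i zero} (rep∈B i))
  ; disjoint = λ { {i} {j} i≢j {K} (K∈i , K∈j) → i≢j (B-unique {i} {j} K K∈i K∈j) }
  ; covering = covering
  }
  where
  rep∈B : ∀ i → rep i zero ∈ B i
  rep∈B i = zero , orbit-refl (rep i zero) (rep i zero) ≐-refl

mainTheorem2 : HasCardinality (Group.setoid (GL-group 8)) G 255
    × (Σ[ B ∈ (Fin 3 → Pred (Subspace 3 8) 0ℓ) ]
    (IsLargeSet 3 2 3 8 21 B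
    × ((i : Fin 3) → AdmitsAutomorphisms G (B i) × ConsistsOfOrbits G 127 (B i))))
mainTheorem2 = G-cardinality , B , largeSet , λ i → admits i , consistsOfOrbits i
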